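{- Suppose that both $2c_1-j_1c_0$ and $2c_1-j_2c_0$ are non-zero. Then for every polynomial $P(x)\in\mathbb R[x]$, the triple $(F_1(x),G_1(x),H_1(x))\in\mathbb R[x]^3$ satisfying $$2\sum_{k=1}^{n}P(k)s_{k-1}=F_1(n)s_{n+1}+G_1(n)s_n+H_1(n)\qquad\text{for all } n\in\mathbb N$$ is unique.
   Context: $\mathbb N$ denotes the positive integers. Fix $a,b\in\mathbb N$ and $c_0,c_1\in\mathbb Z$ with $(c_0,c_1)\neq(0,0)$. The generalized Fibonacci sequence $(s_n)_{n\ge0}$ is defined by $s_0=c_0$, $s_1=c_1$, and $s_{n+1}=as_n+bs_{n-1}$ for all $n\in\mathbb N$. Put $j_1=a+\sqrt{a^2+4b}$ and $j_2=a-\sqrt{a^2+4b}$. -}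

module Defs where

open import Algebra.Bundles.Raw using (RawMonoid)
open import Data.Fin.Base using (toℕ)
open import Data.Integer.Base as ℤ using (ℤ; +_)
import Data.Integer.Properties as ℤ
import Data.Integer.Solver as ℤ-Solver
open import Data.List.Base using (List; []; _∷_)
open import Data.Nat.Base as ℕ using (ℕ; zero; suc; _∸_; s≤s; z≤n; NonZero)
import Data.Nat.Properties as ℕ
open import Data.Nat.Solver using (module +-*-Solver)
open import Data.Product.Base using (∃; _×_; _,_; proj₁; proj₂)
open import Data.Rational.Base as ℚ using (ℚ; mkℚ; 0ℚ; 1ℚ; ∣_∣; *<*)
import Data.Rational.Properties as ℚ
import Data.Rational.Solver as ℚ-Solver
open import Data.Rational.Unnormalised.Base as ℚᵘ using (mkℚᵘ)
import Data.Rational.Unnormalised.Properties as ℚᵘ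
open import Data.Sum.Base using (inj₁; inj₂)
open import Level using (0ℓ)
open import Relation.Binary.PropositionalEquality
open import Relation.Nullary using (¬_; yes; no)

-- The real numbers, as the setoid of Cauchy sequences of rationals.

IsCauchy : (ℕ → ℚ) → Set
IsCauchy x = ∀ ε → 0ℚ ℚ.< ε →
  ∃ λ N → ∀ m n → N ℕ.≤ m → N ℕ.≤ n → ∣ x m ℚ.- x n ∣ ℚ.< ε

record ℝ : Set where
  constructor mkℝ
  field
    seq    : ℕ → ℚ
    cauchy : IsCauchy seq

open ℝ public

infix 4 _≈_ _≉_

-- A record rather than a function, so that x and y can be inferred.
record _≈_ (x y : ℝ) : Set where
  constructor mk≈
  field
    converge : ∀ ε → 0ℚ ℚ.< ε →
      ∃ λ N → ∀ n → N ℕ.≤ n → ∣ seq x n ℚ.- seq y n ∣ ℚ.< ε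

open _≈_ public

_≉_ : ℝ → ℝ → Set
x ≉ y = ¬ (x ≈ y)

module Q = ℚ-Solver.+-*-Solver

cancel : ∀ ε q → (ε ℚ.+ q) ℚ.- q ≡ ε
cancel = Q.solve 2 (λ ε q → (ε Q.:+ q) Q.:+ (Q.:- q) Q.:= ε) refl

sub-add : ∀ a b → a ≡ (a ℚ.- b) ℚ.+ b
sub-add = Q.solve 2 (λ a b → a Q.:= (a Q.:+ (Q.:- b)) Q.:+ b) refl

neg-sub : ∀ p q → q ℚ.- p ≡ ℚ.- (p ℚ.- q)
neg-sub = Q.solve 2 (λ p q → q Q.:+ (Q.:- p) Q.:= Q.:- (p Q.:+ (Q.:- q))) refl

+-diff : ∀ a b a′ b′ → (a ℚ.+ b) ℚ.- (a′ ℚ.+ b′) ≡ (a ℚ.- a′) ℚ.+ (b ℚ.- b′)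
+-diff = Q.solve 4 (λ a b a′ b′ →
  (a Q.:+ b) Q.:+ (Q.:- (a′ Q.:+ b′)) Q.:=
  (a Q.:+ (Q.:- a′)) Q.:+ (b Q.:+ (Q.:- b′))) refl

*-diff : ∀ a b a′ b′ →
  a ℚ.* b ℚ.- a′ ℚ.* b′ ≡ a ℚ.* (b ℚ.- b′) ℚ.+ b′ ℚ.* (a ℚ.- a′)
*-diff = Q.solve 4 (λ a b a′ b′ →
  (a Q.:* b) Q.:+ (Q.:- (a′ Q.:* b′)) Q.:=
  (a Q.:* (b Q.:+ (Q.:- b′))) Q.:+ (b′ Q.:* (a Q.:+ (Q.:- a′)))) refl

half : ∀ {ε} → 0ℚ ℚ.< ε → 0ℚ ℚ.< ε ℚ.* ℚ.½
half {ε} 0<ε = subst (ℚ._< ε ℚ.* ℚ.½) (ℚ.*-zeroˡ ℚ.½) (ℚ.*-monoˡ-<-pos ℚ.½ 0<ε)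

half+half : ∀ ε → ε ℚ.* ℚ.½ ℚ.+ ε ℚ.* ℚ.½ ≡ ε
half+half ε = trans (sym (ℚ.*-distribˡ-+ ε ℚ.½ ℚ.½)) (ℚ.*-identityʳ ε)

∣p-q∣<ε : ∀ {p q ε} → p ℚ.< ε ℚ.+ q → q ℚ.< ε ℚ.+ p → ∣ p ℚ.- q ∣ ℚ.< ε
∣p-q∣<ε {p} {q} {ε} p< q< with ℚ.∣p∣≡p∨∣p∣≡-p (p ℚ.- q)
... | inj₁ e = subst₂ ℚ._<_ (sym e)
  (cancel ε q)
  (ℚ.+-monoˡ-< (ℚ.- q) p<)
... | inj₂ e = subst₂ ℚ._<_
  (trans (neg-sub p q) (sym e))
  (cancel ε p)
  (ℚ.+-monoˡ-< (ℚ.- p) q<)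

infixl 6 _+_ _-_
infixl 7 _*_
infix  8 -_

_+_ : ℝ → ℝ → ℝ
seq    (x + y) n = seq x n ℚ.+ seq y n
cauchy (x + y) ε 0<ε
  with M , p ← cauchy x (ε ℚ.* ℚ.½) (half 0<ε)
     | N , q ← cauchy y (ε ℚ.* ℚ.½) (half 0<ε)
  = M ℕ.⊔ N , λ m n m≥ n≥ →
  let a = seq x m ; a′ = seq x n ; b = seq y m ; b′ = seq y n in
  begin-strict
    ∣ (a ℚ.+ b) ℚ.- (a′ ℚ.+ b′) ∣
      ≡⟨ cong ∣_∣ (+-diff a b a′ b′) ⟩
    ∣ (a ℚ.- a′) ℚ.+ (b ℚ.- b′) ∣
      ≤⟨ ℚ.∣p+q∣≤∣p∣+∣q∣ (a ℚ.- a′) (b ℚ.- b′) ⟩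
    ∣ a ℚ.- a′ ∣ ℚ.+ ∣ b ℚ.- b′ ∣
      <⟨ ℚ.+-mono-< (p m n (ℕ.m⊔n≤o⇒m≤o M N m≥) (ℕ.m⊔n≤o⇒m≤o M N n≥))
                    (q m n (ℕ.m⊔n≤o⇒n≤o M N m≥) (ℕ.m⊔n≤o⇒n≤o M N n≥)) ⟩
    ε ℚ.* ℚ.½ ℚ.+ ε ℚ.* ℚ.½
      ≡⟨ half+half ε ⟩
    ε ∎
  where open ℚ.≤-Reasoning

-_ : ℝ → ℝ
seq    (- x) n = ℚ.- seq x n
cauchy (- x) ε 0<ε with N , p ← cauchy x ε 0<ε = N , λ m n m≥ n≥ →
  subst (ℚ._< ε)
    (trans (sym (ℚ.∣-p∣≡∣p∣ (seq x m ℚ.- seq x n)))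
           (cong ∣_∣ (ℚ.neg-distrib-+ (seq x m) (ℚ.- seq x n))))
    (p m n m≥ n≥)

_-_ : ℝ → ℝ → ℝ
x - y = x + (- y)

bound : ∀ x → IsCauchy x →
  ∃ λ B → 0ℚ ℚ.< B × ∃ λ N → ∀ n → N ℕ.≤ n → ∣ x n ∣ ℚ.≤ B
bound x c with N , p ← c 1ℚ (*<* (ℤ.+<+ (s≤s z≤n))) =
  1ℚ ℚ.+ ∣ x N ∣ , pos , N , λ n n≥ → begin
    ∣ x n ∣
      ≡⟨ cong ∣_∣ (sub-add (x n) (x N)) ⟩
    ∣ (x n ℚ.- x N) ℚ.+ x N ∣
      ≤⟨ ℚ.∣p+q∣≤∣p∣+∣q∣ (x n ℚ.- x N) (x N) ⟩
    ∣ x n ℚ.- x N ∣ ℚ.+ ∣ x N ∣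
      ≤⟨ ℚ.+-monoˡ-≤ ∣ x N ∣ (ℚ.<⇒≤ (p n N n≥ ℕ.≤-refl)) ⟩
    1ℚ ℚ.+ ∣ x N ∣ ∎
  where
  open ℚ.≤-Reasoning
  pos : 0ℚ ℚ.< 1ℚ ℚ.+ ∣ x N ∣
  pos = ℚ.+-mono-<-≤ {0ℚ} {1ℚ} {0ℚ} (*<* (ℤ.+<+ (s≤s z≤n))) (ℚ.0≤∣p∣ (x N))

shrink : ∀ ε D → 0ℚ ℚ.< ε → 0ℚ ℚ.< D → ∃ λ δ → 0ℚ ℚ.< δ × D ℚ.* δ ≡ ε
shrink ε D@record{} 0<ε 0<D = i ℚ.* ε , 0<δ , eq
  where
  i = (ℚ.1/ D) {{ℚ.>-nonZero 0<D}}
  i-pos = ℚ.1/pos⇒pos D {{ℚ.positive 0<D}}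
  0<δ : 0ℚ ℚ.< i ℚ.* ε
  0<δ = subst (ℚ._< i ℚ.* ε) (ℚ.*-zeroʳ i) (ℚ.*-monoʳ-<-pos i {{i-pos}} 0<ε)
  eq : D ℚ.* (i ℚ.* ε) ≡ ε
  eq = trans (sym (ℚ.*-assoc D i ε))
      (trans (cong (ℚ._* ε) (ℚ.*-inverseʳ D {{ℚ.>-nonZero 0<D}})) (ℚ.*-identityˡ ε))

*-close : ∀ {B C δ} → 0ℚ ℚ.< B → 0ℚ ℚ.< C → ∀ a b a′ b′ →
  ∣ a ∣ ℚ.≤ B → ∣ b′ ∣ ℚ.≤ C → ∣ a ℚ.- a′ ∣ ℚ.< δ → ∣ b ℚ.- b′ ∣ ℚ.< δ →
  ∣ a ℚ.* b ℚ.- a′ ℚ.* b′ ∣ ℚ.< (B ℚ.+ C) ℚ.* δ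
*-close {B} {C} {δ} 0<B 0<C a b a′ b′ a≤ b′≤ aa′ bb′ = begin-strict
  ∣ a ℚ.* b ℚ.- a′ ℚ.* b′ ∣
    ≡⟨ cong ∣_∣ (*-diff a b a′ b′) ⟩
  ∣ a ℚ.* (b ℚ.- b′) ℚ.+ b′ ℚ.* (a ℚ.- a′) ∣
    ≤⟨ ℚ.∣p+q∣≤∣p∣+∣q∣ (a ℚ.* (b ℚ.- b′)) (b′ ℚ.* (a ℚ.- a′)) ⟩
  ∣ a ℚ.* (b ℚ.- b′) ∣ ℚ.+ ∣ b′ ℚ.* (a ℚ.- a′) ∣
    ≡⟨ cong₂ ℚ._+_ (ℚ.∣p*q∣≡∣p∣*∣q∣ a (b ℚ.- b′)) (ℚ.∣p*q∣≡∣p∣*∣q∣ b′ (a ℚ.- a′)) ⟩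
  ∣ a ∣ ℚ.* ∣ b ℚ.- b′ ∣ ℚ.+ ∣ b′ ∣ ℚ.* ∣ a ℚ.- a′ ∣
    ≤⟨ ℚ.+-mono-≤
         (ℚ.*-monoʳ-≤-nonNeg ∣ b ℚ.- b′ ∣ {{ℚ.∣-∣-nonNeg (b ℚ.- b′)}} a≤)
         (ℚ.*-monoʳ-≤-nonNeg ∣ a ℚ.- a′ ∣ {{ℚ.∣-∣-nonNeg (a ℚ.- a′)}} b′≤) ⟩
  B ℚ.* ∣ b ℚ.- b′ ∣ ℚ.+ C ℚ.* ∣ a ℚ.- a′ ∣
    <⟨ ℚ.+-mono-< (ℚ.*-monoʳ-<-pos B {{ℚ.positive 0<B}} bb′)
                  (ℚ.*-monoʳ-<-pos C {{ℚ.positive 0<C}} aa′) ⟩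
  B ℚ.* δ ℚ.+ C ℚ.* δ
    ≡⟨ sym (ℚ.*-distribʳ-+ δ B C) ⟩
  (B ℚ.+ C) ℚ.* δ ∎
  where open ℚ.≤-Reasoning

*-cauchy : ∀ x y → IsCauchy x → IsCauchy y → IsCauchy (λ n → x n ℚ.* y n)
*-cauchy x y cx cy ε 0<ε = go (bound x cx) (bound y cy)
  where
  go″ : ∀ {B C δ} → 0ℚ ℚ.< B → 0ℚ ℚ.< C → (B ℚ.+ C) ℚ.* δ ≡ ε →
    (∃ λ N → ∀ n → N ℕ.≤ n → ∣ x n ∣ ℚ.≤ B) →
    (∃ λ N → ∀ n → N ℕ.≤ n → ∣ y n ∣ ℚ.≤ C) →
    (∃ λ N → ∀ m n → N ℕ.≤ m → N ℕ.≤ n → ∣ x m ℚ.- x n ∣ ℚ.< δ) →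
    (∃ λ N → ∀ m n → N ℕ.≤ m → N ℕ.≤ n → ∣ y m ℚ.- y n ∣ ℚ.< δ) →
    ∃ λ N → ∀ m n → N ℕ.≤ m → N ℕ.≤ n → ∣ x m ℚ.* y m ℚ.- x n ℚ.* y n ∣ ℚ.< ε
  go″ 0<B 0<C eq (K , f) (L , g) (M , p) (N , q) =
    (M ℕ.⊔ N) ℕ.⊔ (K ℕ.⊔ L) , λ m n m≥ n≥ →
    let u = ℕ.m⊔n≤o⇒m≤o (M ℕ.⊔ N) (K ℕ.⊔ L) m≥
        v = ℕ.m⊔n≤o⇒m≤o (M ℕ.⊔ N) (K ℕ.⊔ L) n≥
        k = ℕ.m⊔n≤o⇒m≤o K L (ℕ.m⊔n≤o⇒n≤o (M ℕ.⊔ N) (K ℕ.⊔ L) m≥)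
        l = ℕ.m⊔n≤o⇒n≤o K L (ℕ.m⊔n≤o⇒n≤o (M ℕ.⊔ N) (K ℕ.⊔ L) n≥)
    in subst (∣ x m ℚ.* y m ℚ.- x n ℚ.* y n ∣ ℚ.<_) eq
         (*-close 0<B 0<C (x m) (y m) (x n) (y n) (f m k) (g n l)
           (p m n (ℕ.m⊔n≤o⇒m≤o M N u) (ℕ.m⊔n≤o⇒m≤o M N v))
           (q m n (ℕ.m⊔n≤o⇒n≤o M N u) (ℕ.m⊔n≤o⇒n≤o M N v)))

  go′ : ∀ {B C} → 0ℚ ℚ.< B → 0ℚ ℚ.< C →
    (∃ λ N → ∀ n → N ℕ.≤ n → ∣ x n ∣ ℚ.≤ B) →
    (∃ λ N → ∀ n → N ℕ.≤ n → ∣ y n ∣ ℚ.≤ C) →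
    (∃ λ δ → 0ℚ ℚ.< δ × (B ℚ.+ C) ℚ.* δ ≡ ε) →
    ∃ λ N → ∀ m n → N ℕ.≤ m → N ℕ.≤ n → ∣ x m ℚ.* y m ℚ.- x n ℚ.* y n ∣ ℚ.< ε
  go′ 0<B 0<C f g (δ , 0<δ , eq) = go″ 0<B 0<C eq f g (cx δ 0<δ) (cy δ 0<δ)

  go : (∃ λ B → 0ℚ ℚ.< B × ∃ λ N → ∀ n → N ℕ.≤ n → ∣ x n ∣ ℚ.≤ B) →
    (∃ λ C → 0ℚ ℚ.< C × ∃ λ N → ∀ n → N ℕ.≤ n → ∣ y n ∣ ℚ.≤ C) →
    ∃ λ N → ∀ m n → N ℕ.≤ m → N ℕ.≤ n → ∣ x m ℚ.* y m ℚ.- x n ℚ.* y n ∣ ℚ.< ε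
  go (B , 0<B , f) (C , 0<C , g) =
    go′ 0<B 0<C f g (shrink ε (B ℚ.+ C) 0<ε (ℚ.+-mono-< {0ℚ} {B} {0ℚ} 0<B 0<C))

_*_ : ℝ → ℝ → ℝ
seq    (x * y) n = seq x n ℚ.* seq y n
cauchy (x * y)   = *-cauchy (seq x) (seq y) (cauchy x) (cauchy y)

fromℚ : ℚ → ℝ
seq    (fromℚ q) _ = q
cauchy (fromℚ q) ε 0<ε = 0 , λ _ _ _ _ →
  subst (ℚ._< ε) (sym (cong ∣_∣ (ℚ.+-inverseʳ q))) 0<ε

fromℤ : ℤ → ℝ
fromℤ i = fromℚ (i ℚ./ 1)

fromℕ : ℕ → ℝ
fromℕ n = fromℤ (+ n)

0ℝ : ℝ
0ℝ = fromℕ 0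

-- The integer square root: the largest r with r * r ≤ n.
isqrt : ℕ → ℕ
isqrt zero    = 0
isqrt (suc n) with suc (isqrt n) ℕ.* suc (isqrt n) ℕ.≤? suc n
... | yes _ = suc (isqrt n)
... | no  _ = isqrt n

isqrt-spec : ∀ n → isqrt n ℕ.* isqrt n ℕ.≤ n × n ℕ.< suc (isqrt n) ℕ.* suc (isqrt n)
isqrt-spec zero = z≤n , s≤s z≤n
isqrt-spec (suc n)
  with suc (isqrt n) ℕ.* suc (isqrt n) ℕ.≤? suc n | isqrt-spec n
... | yes p | lo , hi = p ,
  ℕ.≤-<-trans hi (ℕ.*-mono-< (ℕ.n<1+n (suc (isqrt n))) (ℕ.n<1+n (suc (isqrt n))))
... | no ¬p | lo , hi = ℕ.m≤n⇒m≤1+n lo , ℕ.≰⇒> ¬p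

approx : ℕ → ℕ → ℕ
approx n q = isqrt (n ℕ.* (q ℕ.* q))

cross : ∀ n q q′ .{{_ : NonZero q}} .{{_ : NonZero q′}} →
  approx n q ℕ.* q′ ℕ.< suc (approx n q′) ℕ.* q
cross n q q′ = ℕ.≰⇒> λ le → ℕ.<-irrefl refl (begin-strict
  (p ℕ.* q′) ℕ.* (p ℕ.* q′)
    ≡⟨ sq p q′ ⟩
  (p ℕ.* p) ℕ.* (q′ ℕ.* q′)
    ≤⟨ ℕ.*-monoˡ-≤ (q′ ℕ.* q′) (proj₁ (isqrt-spec (n ℕ.* (q ℕ.* q)))) ⟩
  (n ℕ.* (q ℕ.* q)) ℕ.* (q′ ℕ.* q′)
    ≡⟨ solve 3 (λ n a b → (n :* a) :* b := (n :* b) :* a) refl n (q ℕ.* q) (q′ ℕ.* q′) ⟩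
  (n ℕ.* (q′ ℕ.* q′)) ℕ.* (q ℕ.* q)
    <⟨ ℕ.*-monoˡ-< (q ℕ.* q) {{ℕ.m*n≢0 q q}} (proj₂ (isqrt-spec (n ℕ.* (q′ ℕ.* q′)))) ⟩
  (suc p′ ℕ.* suc p′) ℕ.* (q ℕ.* q)
    ≡⟨ sym (sq (suc p′) q) ⟩
  (suc p′ ℕ.* q) ℕ.* (suc p′ ℕ.* q)
    ≤⟨ ℕ.*-mono-≤ le le ⟩
  (p ℕ.* q′) ℕ.* (p ℕ.* q′) ∎)
  where
  open ℕ.≤-Reasoning
  open +-*-Solver
  p  = approx n q
  p′ = approx n q′
  sq : ∀ a b → (a ℕ.* b) ℕ.* (a ℕ.* b) ≡ (a ℕ.* a) ℕ.* (b ℕ.* b)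
  sq = solve 2 (λ a b → (a :* b) :* (a :* b) := (a :* a) :* (b :* b)) refl

√-seq : ℕ → ℕ → ℚ
√-seq n k = + isqrt (n ℕ.* (suc k ℕ.* suc k)) ℚ./ suc k

suc-/ : ∀ p l → mkℚᵘ (+ suc p) l ℚᵘ.≃ mkℚᵘ (+ 1) l ℚᵘ.+ mkℚᵘ (+ p) l
suc-/ p l = ℚᵘ.*≡* (solve 2
  (λ p l → (con (+ 1) :+ p) :* (l :* l) :=
           (con (+ 1) :* l :+ p :* l) :* l) refl (+ p) (+ suc l))
  where open ℤ-Solver.+-*-Solver

cross-ℚ : ∀ n k l → √-seq n k ℚ.< (+ 1 ℚ./ suc l) ℚ.+ √-seq n l
cross-ℚ n k l = ℚ.toℚᵘ-cancel-< (begin-strict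
  ℚ.toℚᵘ (+ p ℚ./ suc k)
    ≃⟨ ℚ.toℚᵘ-fromℚᵘ (mkℚᵘ (+ p) k) ⟩
  mkℚᵘ (+ p) k
    <⟨ ℚᵘ.*<* (subst₂ ℤ._<_ (ℤ.pos-* p (suc l)) (ℤ.pos-* (suc p′) (suc k))
         (ℤ.+<+ (cross n (suc k) (suc l)))) ⟩
  mkℚᵘ (+ suc p′) l
    ≃⟨ suc-/ p′ l ⟩
  mkℚᵘ (+ 1) l ℚᵘ.+ mkℚᵘ (+ p′) l
    ≃⟨ ℚᵘ.+-cong (ℚᵘ.≃-sym (ℚ.toℚᵘ-fromℚᵘ (mkℚᵘ (+ 1) l)))
                 (ℚᵘ.≃-sym (ℚ.toℚᵘ-fromℚᵘ (mkℚᵘ (+ p′) l))) ⟩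
  ℚ.toℚᵘ (+ 1 ℚ./ suc l) ℚᵘ.+ ℚ.toℚᵘ (+ p′ ℚ./ suc l)
    ≃⟨ ℚᵘ.≃-sym (ℚ.toℚᵘ-homo-+ (+ 1 ℚ./ suc l) (+ p′ ℚ./ suc l)) ⟩
  ℚ.toℚᵘ ((+ 1 ℚ./ suc l) ℚ.+ (+ p′ ℚ./ suc l)) ∎)
  where
  open ℚᵘ.≤-Reasoning
  p  = approx n (suc k)
  p′ = approx n (suc l)

1/suc<ε : ∀ ε → 0ℚ ℚ.< ε → ∃ λ N → ∀ k → N ℕ.≤ k → + 1 ℚ./ suc k ℚ.< ε
1/suc<ε (mkℚ (+ 0)         d _) (*<* (ℤ.+<+ ()))
1/suc<ε (mkℚ ℤ.-[1+ _ ]    d _) (*<* ())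
1/suc<ε ε@(mkℚ ℤ.+[1+ m ] d _) _ = suc d , λ k d<k → ℚ.toℚᵘ-cancel-< (begin-strict
  ℚ.toℚᵘ (+ 1 ℚ./ suc k)
    ≃⟨ ℚ.toℚᵘ-fromℚᵘ (mkℚᵘ (+ 1) k) ⟩
  mkℚᵘ (+ 1) k
    <⟨ ℚᵘ.*<* (subst₂ ℤ._<_ (ℤ.pos-* 1 (suc d)) (ℤ.pos-* (suc m) (suc k))
         (ℤ.+<+ (ℕ.<-≤-trans (s≤s (ℕ.≤-trans (ℕ.≤-reflexive (ℕ.*-identityˡ (suc d))) d<k))
                             (ℕ.m≤m+n (suc k) (m ℕ.* suc k))))) ⟩
  mkℚᵘ ℤ.+[1+ m ] d
    ∎)
  where open ℚᵘ.≤-Reasoning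

√-cauchy : ∀ n → IsCauchy (√-seq n)
√-cauchy n ε 0<ε with N , f ← 1/suc<ε ε 0<ε = N , λ k l k≥ l≥ →
  ∣p-q∣<ε (ℚ.<-trans (cross-ℚ n k l) (ℚ.+-monoˡ-< (√-seq n l) (f l l≥)))
          (ℚ.<-trans (cross-ℚ n l k) (ℚ.+-monoˡ-< (√-seq n k) (f k k≥)))

-- The k-th approximation of √ n is ⌊√ n · (k + 1)⌋ / (k + 1).
√ : ℕ → ℝ
√ n = mkℝ (√-seq n) (√-cauchy n)

-- Polynomials over ℝ, as lists of coefficients starting with the constant
-- term. Trailing zeros are allowed, so equality is coefficientwise.

ℝ[x] : Set
ℝ[x] = List ℝ

coeff : ℝ[x] → ℕ → ℝ
coeff []       _       = 0ℝ
coeff (c ∷ p)  zero    = c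
coeff (c ∷ p)  (suc i) = coeff p i

infix 4 _≈ₚ_

_≈ₚ_ : ℝ[x] → ℝ[x] → Set
p ≈ₚ q = ∀ i → coeff p i ≈ coeff q i

eval : ℝ[x] → ℝ → ℝ
eval []      x = 0ℝ
eval (c ∷ p) x = c + x * eval p x

fib : (a b : ℕ) (c₀ c₁ : ℤ) → ℕ → ℤ
fib a b c₀ c₁ 0             = c₀
fib a b c₀ c₁ 1             = c₁
fib a b c₀ c₁ (suc (suc n)) =
  + a ℤ.* fib a b c₀ c₁ (suc n) ℤ.+ + b ℤ.* fib a b c₀ c₁ n

j₁ j₂ : ℕ → ℕ → ℝ
j₁ a b = fromℕ a + √ (a ℕ.^ 2 ℕ.+ 4 ℕ.* b)
j₂ a b = fromℕ a - √ (a ℕ.^ 2 ℕ.+ 4 ℕ.* b)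

+-0-rawMonoid : RawMonoid 0ℓ 0ℓ
+-0-rawMonoid = record { _≈_ = _≈_ ; _∙_ = _+_ ; ε = 0ℝ }

open import Algebra.Definitions.RawMonoid +-0-rawMonoid using (sum)

-- f 1 + f 2 + ⋯ + f n
∑₁ : ℕ → (ℕ → ℝ) → ℝ
∑₁ n f = sum {n} λ i → f (suc (toℕ i))

SumFormula : (a b : ℕ) (c₀ c₁ : ℤ) → ℝ[x] → ℝ[x] × ℝ[x] × ℝ[x] → Set
SumFormula a b c₀ c₁ P (F , G , H) = ∀ n → .{{NonZero n}} →
  fromℕ 2 * ∑₁ n (λ k → eval P (fromℕ k) * s (k ∸ 1))
    ≈ eval F (fromℕ n) * s (n ℕ.+ 1) + eval G (fromℕ n) * s n + eval H (fromℕ n)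
  where
  s : ℕ → ℝ
  s n = fromℤ (fib a b c₀ c₁ n)

{-# OPTIONS --safe #-}

-- Subtracting two solutions gives polynomials f, g, h with
-- f(n) s(n+1) + g(n) s(n) + h(n) = 0 for all n ≥ 1. Differencing removes h: on the
-- pair (f , g) it is an injective operator because a + b ≠ 1. Then E² - a E - b, with E
-- the shift, kills s and so lowers the degree of (f , g), with a symbol of
-- determinant b (a² + 4 b) ≠ 0; this reduces to constant f and g, where the Casoratian
-- s(2)² - s(1) s(3) forces f = g = 0. Up to a nonzero factor the Casoratian is the
-- product of 2 c₁ - j₁ c₀ and 2 c₁ - j₂ c₀. It is an integer, so every cancellation is by
-- a nonzero integer and no apartness of reals is needed.
module Submission where

open import Algebra.Bundles using (CommutativeRing)
import Algebra.Definitions.RawMonoid as RawMonoidDefinitions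
import Algebra.Properties.Group
import Algebra.Solver.Ring
open import Algebra.Solver.Ring.AlmostCommutativeRing
  using (fromCommutativeRing; _-Raw-AlmostCommutative⟶_)
open import Data.Fin.Base using (Fin; zero; suc)
open import Data.Integer.Base as ℤ using (ℤ; +_; 0ℤ)
import Data.Integer.Properties as ℤ
import Data.Integer.Solver as ℤ-Solver
open import Data.List.Base using ([]; _∷_; length; drop)
open import Data.Maybe.Base as Maybe using ()
open import Data.Nat.Base as ℕ using (ℕ; zero; suc; NonZero)
import Data.Nat.Properties as ℕ
import Data.Nat.Solver as ℕ-Solver
open import Data.Product.Base using (∃; _×_; _,_; proj₁; proj₂)
open import Data.Rational.Base as ℚ using (ℚ; 0ℚ; ∣_∣)
import Data.Rational.Properties as ℚ
open import Data.Rational.Unnormalised.Base as ℚᵘ using (mkℚᵘ)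
import Data.Rational.Unnormalised.Properties as ℚᵘ
open import Data.Sum.Base using (_⊎_; inj₁; inj₂; [_,_]′)
open import Function.Base using (id; _∘_)
open import Level using (0ℓ)
open import Relation.Binary.PropositionalEquality as ≡ using (_≡_)
open import Relation.Nullary using (¬_)
open import Relation.Nullary.Decidable using (dec⇒maybe)

-- Finite differences of sequences in a commutative ring.

module Sequences {c ℓ} (R : CommutativeRing c ℓ)
  (ℤ⟶R : CommutativeRing.rawRing ℤ.+-*-commutativeRing
          -Raw-AlmostCommutative⟶ fromCommutativeRing R)
  where

  open CommutativeRing R hiding (zero) renaming (Carrier to A)
  open Algebra.Properties.Group +-group using ()
    renaming (x∙y⁻¹≈ε⇒x≈y to x-y≈0⇒x≈y; x≈y⇒x∙y⁻¹≈ε to -≈0)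
  open _-Raw-AlmostCommutative⟶_ ℤ⟶R using (⟦_⟧)
  open Algebra.Solver.Ring
    (CommutativeRing.rawRing ℤ.+-*-commutativeRing) (fromCommutativeRing R) ℤ⟶R
    (λ i j → Maybe.map (λ i≡j → reflexive (≡.cong ⟦_⟧ i≡j)) (dec⇒maybe (i ℤ.≟ j)))
    using (solve; _:=_; _:+_; _:-_; _:*_; :-_; con) public

  infixr 6 _⊕_
  infixr 7 _⊙_

  -- The elements equal to 0 form an ideal. Many solver identities below write their target as a
  -- combination of quantities known to vanish, and `_⊕_` and `_⊙_` then finish.
  _⊕_ : ∀ {x y} → x ≈ 0# → y ≈ 0# → x + y ≈ 0#
  x≈0 ⊕ y≈0 = trans (+-cong x≈0 y≈0) (+-identityˡ 0#)

  _⊙_ : ∀ {x} u → x ≈ 0# → u * x ≈ 0#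
  u ⊙ x≈0 = trans (*-congˡ x≈0) (zeroʳ u)

  -- Cancellability replaces invertibility, so that no division in the ring is required.
  Regular : A → Set _
  Regular x = ∀ {y} → x * y ≈ 0# → y ≈ 0#

  regular-* : ∀ {x y} → Regular x → Regular y → Regular (x * y)
  regular-* rx ry xyz≈0 = ry (rx (trans (sym (*-assoc _ _ _)) xyz≈0))

  Zero : (ℕ → A) → Set _
  Zero f = ∀ n → f n ≈ 0#

  Δ : (ℕ → A) → ℕ → A
  Δ f n = f (suc n) - f n

  -- Over a ℚ-algebra these are the polynomial functions of degree less than k.
  Deg< : ℕ → (ℕ → A) → Set _
  Deg< zero    f = Zero f
  Deg< (suc k) f = Deg< k (Δ f)

  deg-cong : ∀ k {f g} → (∀ n → f n ≈ g n) → Deg< k f → Deg< k g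
  deg-cong zero    f≈g d = λ n → trans (sym (f≈g n)) (d n)
  deg-cong (suc k) f≈g = deg-cong k λ n → +-cong (f≈g (suc n)) (-‿cong (f≈g n))

  deg-shift : ∀ k {f} → Deg< k f → Deg< k (λ n → f (suc n))
  deg-shift zero    d = λ n → d (suc n)
  deg-shift (suc k) d = deg-shift k d

  deg-+ : ∀ k {f g} → Deg< k f → Deg< k g → Deg< k (λ n → f n + g n)
  deg-+ zero    d e = λ n → d n ⊕ e n
  deg-+ (suc k) {f} {g} d e = deg-cong k
    (λ n → solve 4 (λ f₁ f₀ g₁ g₀ → (f₁ :- f₀) :+ (g₁ :- g₀) := (f₁ :+ g₁) :- (f₀ :+ g₀)) refl
      (f (suc n)) (f n) (g (suc n)) (g n))
    (deg-+ k d e)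

  deg-* : ∀ k u {f} → Deg< k f → Deg< k (λ n → u * f n)
  deg-* zero    u d = λ n → u ⊙ d n
  deg-* (suc k) u {f} d = deg-cong k
    (λ n → solve 3 (λ u f₁ f₀ → u :* (f₁ :- f₀) := u :* f₁ :- u :* f₀) refl u (f (suc n)) (f n))
    (deg-* k u d)

  deg-- : ∀ k {f g} → Deg< k f → Deg< k g → Deg< k (λ n → f n - g n)
  deg-- k {f} {g} d e = deg-cong k
    (λ n → solve 2 (λ x y → x :+ con (ℤ.- + 1) :* y := x :- y) refl (f n) (g n))
    (deg-+ k d (deg-* k ⟦ ℤ.- + 1 ⟧ e))

  deg-suc : ∀ k {f} → Deg< k f → Deg< (suc k) f
  deg-suc zero    d = λ n → -≈0 (trans (d (suc n)) (sym (d n)))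
  deg-suc (suc k) d = deg-suc k d

  deg-≤ : ∀ {k l f} → k ℕ.≤ l → Deg< k f → Deg< l f
  deg-≤ {l = zero}  ℕ.z≤n d = d
  deg-≤ {l = suc l} ℕ.z≤n d = deg-suc l (deg-≤ {l = l} ℕ.z≤n d)
  deg-≤ (ℕ.s≤s k≤l) d = deg-≤ k≤l d

  Δ≈0⇒const : ∀ {f} → Zero (Δ f) → ∀ n → f n ≈ f 0
  Δ≈0⇒const d zero    = refl
  Δ≈0⇒const d (suc n) = trans (x-y≈0⇒x≈y _ _ (d n)) (Δ≈0⇒const d n)

  -- Recovers the value at 0 from those at positive indices: by induction `Δ f` vanishes everywhere,
  -- so `f` is constant and equal to `f 1`.
  zero-extend : ∀ k {f} → Deg< k f → (∀ n → f (suc n) ≈ 0#) → Zero f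
  zero-extend zero    d z = d
  zero-extend (suc k) {f} d z n =
    trans (Δ≈0⇒const Δf≈0 n) (trans (sym (Δ≈0⇒const Δf≈0 1)) (z 0))
    where
    Δf≈0 : Zero (Δ f)
    Δf≈0 = zero-extend k d λ n → -≈0 (trans (z (suc n)) (sym (z n)))

  -- Polynomial functions of a sequence with constant difference 1.

  module Polynomial (x : ℕ → A) (x-suc : ∀ n → x (suc n) ≈ x n + 1#) where

    deg-const : ∀ u → Deg< 1 (λ _ → u)
    deg-const u n = -‿inverseʳ u

    -- Leibniz rule with `Δ x = 1`: the difference of `x f` at `n` is `x n * Δ f n + f (suc n)`.
    -- Induction bounds the first summand, a shift the second.
    deg-x* : ∀ k {f} → Deg< k f → Deg< (suc k) (λ n → x n * f n)
    deg-x* zero    d = deg-suc zero λ n → x n ⊙ d n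
    deg-x* (suc k) {f} d = deg-cong (suc k) eq
      (deg-+ (suc k) (deg-x* k d) (deg-shift (suc k) d))
      where
      eq : ∀ n → x n * (f (suc n) - f n) + f (suc n) ≈ x (suc n) * f (suc n) - x n * f n
      eq n = trans
        (solve 4 (λ x o f₁ f₀ → x :* (f₁ :- f₀) :+ f₁ := x :* f₁ :+ f₁ :- x :* f₀) refl
          (x n) 1# (f (suc n)) (f n))
        (+-congʳ (sym (trans (*-congʳ (x-suc n)) (trans (distribʳ _ _ _) (+-congˡ (*-identityˡ _))))))

    module _ (x₀≈0 : x 0 ≈ 0#) (x-regular : ∀ n → Regular (x (suc n))) where

      -- The relation extends from positive indices to 0 by `zero-extend`. There `x 0 = 0` leaves
      -- only `c`, and afterwards `x (suc n)` cancels. This separates the constant coefficient of a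
      -- polynomial from the rest.
      head-tail≈0 : ∀ k {c f} → Deg< k f → (∀ n → c + x (suc n) * f (suc n) ≈ 0#) →
        c ≈ 0# × (∀ n → f (suc n) ≈ 0#)
      head-tail≈0 k {c} {f} d z = c≈0 , λ n → x-regular n
        (trans (sym (trans (+-congʳ c≈0) (+-identityˡ _))) (z n))
        where
        c≈0 : c ≈ 0#
        c≈0 = trans
          (sym (trans (+-congˡ (trans (*-congʳ x₀≈0) (zeroˡ _))) (+-identityʳ c)))
          (zero-extend (suc k)
            (deg-+ (suc k) (deg-≤ (ℕ.s≤s (ℕ.z≤n {k})) (deg-const c)) (deg-x* k d)) z 0)

  -- Relations between solutions of a linear recurrence.

  -- Write M for the action (f , g) ↦ (a f + g , b f) of the shift E on constant
  -- coefficients of s (n + 1) and s n. The operators E - 1 and N on coefficients have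
  -- the form X + Δ Y with X a polynomial in M of regular determinant, which is why
  -- they are injective on sequences killed by a power of Δ.
  module Recurrence (a b : A) where

    module _ (a+b-1-regular : Regular (a + b - 1#)) where

      -- Both conditions commute with `Δ`, so the induction hypothesis makes `f` and `g` constant.
      -- For constants they read `a f + g = f` and `b f = g`, and their sum gives
      -- `(a + b - 1) f = 0`.
      E-1-injective : ∀ k {f g} → Deg< k f → Deg< k g →
        (∀ n → a * f (suc n) + g (suc n) - f n ≈ 0#) →
        (∀ n → b * f (suc n) - g n ≈ 0#) →
        Zero f × Zero g
      E-1-injective zero    d e _ _ = d , e
      E-1-injective (suc k) {f} {g} d e P Q = f≈0 , g≈0
        where
        IH : Zero (Δ f) × Zero (Δ g)
        IH = E-1-injective k d e
          (λ n → trans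
            (solve 6 (λ a f₂ f₁ f₀ g₂ g₁ →
              a :* (f₂ :- f₁) :+ (g₂ :- g₁) :- (f₁ :- f₀) :=
              (a :* f₂ :+ g₂ :- f₁) :- (a :* f₁ :+ g₁ :- f₀)) refl
              a (f (suc (suc n))) (f (suc n)) (f n) (g (suc (suc n))) (g (suc n)))
            (-≈0 (trans (P (suc n)) (sym (P n)))))
          (λ n → trans
            (solve 5 (λ b f₂ f₁ g₁ g₀ →
              b :* (f₂ :- f₁) :- (g₁ :- g₀) := (b :* f₂ :- g₁) :- (b :* f₁ :- g₀)) refl
              b (f (suc (suc n))) (f (suc n)) (g (suc n)) (g n))
            (-≈0 (trans (Q (suc n)) (sym (Q n)))))
        f≈0 : Zero f
        f≈0 n = a+b-1-regular (trans
          -- The regularity hypothesis mentions `1#`, which enters as the atom `o`; `*-identityˡ`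
          -- then matches `o * f₀` with the `f n` in `P n`.
          (solve 7 (λ a b o f₁ f₀ g₁ g₀ →
            (a :+ b :- o) :* f₀ :=
            (a :* f₁ :+ g₁ :- o :* f₀) :+ (b :* f₁ :- g₀)
              :+ (:- (a :+ b) :* (f₁ :- f₀) :+ (:- con (+ 1)) :* (g₁ :- g₀))) refl
            a b 1# (f (suc n)) (f n) (g (suc n)) (g n))
          ((trans (+-congˡ (-‿cong (*-identityˡ _))) (P n) ⊕ Q n) ⊕ (_ ⊙ proj₁ IH n ⊕ _ ⊙ proj₂ IH n)))
        g≈0 : Zero g
        g≈0 n = trans (sym (x-y≈0⇒x≈y _ _ (Q n))) (b ⊙ f≈0 (suc n))

    module _ (b-regular : Regular b) (disc-regular : Regular (a * a + ⟦ + 4 ⟧ * b)) where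

      -- The components of `N = a M E + b (E + 1)`, where `E` shifts coefficients. Applying
      -- `E² - a E - b` to a relation acts on coefficients as `M² E² - a M E - b`; by
      -- Cayley-Hamilton, `M² = a M + b`, and this factors as `N Δ`.
      Nᶠ Nᵍ : (ℕ → A) → (ℕ → A) → ℕ → A
      Nᶠ f g n = a * (a * f (suc n) + g (suc n)) + b * (f (suc n) + f n)
      Nᵍ f g n = a * b * f (suc n) + b * (g (suc n) + g n)

      -- `N` commutes with `Δ`, so the induction hypothesis makes `f` and `g` constant. On constants
      -- `N` is the matrix `a M + 2 b`, of determinant `b (a² + 4 b)`; the rows of its adjugate are
      -- the multipliers of `P n` and `Q n` below.
      N-injective : ∀ k {f g} → Deg< k f → Deg< k g → Zero (Nᶠ f g) → Zero (Nᵍ f g) →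
        Zero f × Zero g
      N-injective zero    d e _ _ = d , e
      N-injective (suc k) {f} {g} d e P Q = f≈0 , g≈0
        where
        IH : Zero (Δ f) × Zero (Δ g)
        IH = N-injective k d e
          (λ n → trans
            (solve 7 (λ a b f₂ f₁ f₀ g₂ g₁ →
              a :* (a :* (f₂ :- f₁) :+ (g₂ :- g₁)) :+ b :* ((f₂ :- f₁) :+ (f₁ :- f₀)) :=
              (a :* (a :* f₂ :+ g₂) :+ b :* (f₂ :+ f₁)) :- (a :* (a :* f₁ :+ g₁) :+ b :* (f₁ :+ f₀))) refl
              a b (f (suc (suc n))) (f (suc n)) (f n) (g (suc (suc n))) (g (suc n)))
            (-≈0 (trans (P (suc n)) (sym (P n)))))
          (λ n → trans
            (solve 7 (λ a b f₂ f₁ g₂ g₁ g₀ →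
              a :* b :* (f₂ :- f₁) :+ b :* ((g₂ :- g₁) :+ (g₁ :- g₀)) :=
              (a :* b :* f₂ :+ b :* (g₂ :+ g₁)) :- (a :* b :* f₁ :+ b :* (g₁ :+ g₀))) refl
              a b (f (suc (suc n))) (f (suc n)) (g (suc (suc n))) (g (suc n)) (g n))
            (-≈0 (trans (Q (suc n)) (sym (Q n)))))
        f≈0 : Zero f
        f≈0 n = regular-* b-regular disc-regular (trans
          (solve 6 (λ a b f₁ f₀ g₁ g₀ →
            b :* (a :* a :+ con (+ 4) :* b) :* f₀ :=
            con (+ 2) :* b :* (a :* (a :* f₁ :+ g₁) :+ b :* (f₁ :+ f₀))
              :+ ((:- a) :* (a :* b :* f₁ :+ b :* (g₁ :+ g₀))
              :+ ((:- (a :* a :* b :+ con (+ 2) :* b :* b)) :* (f₁ :- f₀)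
              :+ (:- (a :* b)) :* (g₁ :- g₀)))) refl
            a b (f (suc n)) (f n) (g (suc n)) (g n))
          (_ ⊙ P n ⊕ _ ⊙ Q n ⊕ _ ⊙ proj₁ IH n ⊕ _ ⊙ proj₂ IH n))
        g≈0 : Zero g
        g≈0 n = regular-* b-regular disc-regular (trans
          (solve 6 (λ a b f₁ f₀ g₁ g₀ →
            b :* (a :* a :+ con (+ 4) :* b) :* g₀ :=
            (:- (a :* b)) :* (a :* (a :* f₁ :+ g₁) :+ b :* (f₁ :+ f₀))
              :+ ((a :* a :+ con (+ 2) :* b) :* (a :* b :* f₁ :+ b :* (g₁ :+ g₀))
              :+ ((:- (a :* b :* b)) :* (f₁ :- f₀)
              :+ (:- (con (+ 2) :* b :* b)) :* (g₁ :- g₀)))) refl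
            a b (f (suc n)) (f n) (g (suc n)) (g n))
          (_ ⊙ P n ⊕ _ ⊙ Q n ⊕ _ ⊙ proj₁ IH n ⊕ _ ⊙ proj₂ IH n))

      module _ (s : ℕ → A) (s-rec : ∀ n → s (suc (suc n)) ≈ a * s (suc n) + b * s n)
        (casoratian-regular : Regular (s 1 * s 1 - s 0 * s 2)) where

        -- `NΔ-relation` is again homogeneous, with coefficients of lower degree, so these vanish by
        -- induction and `N-injective` gives `Δ f = Δ g = 0`. For constant `f` and `g` the relations
        -- at 0 and 1 are a linear system whose determinant is the Casoratian.
        homogeneous : ∀ k {f g} → Deg< k f → Deg< k g →
          (∀ n → f n * s (suc n) + g n * s n ≈ 0#) → Zero f × Zero g
        homogeneous zero    d e _ = d , e
        homogeneous (suc k) {f} {g} d e r = const-zero Δf≈0 f₀≈0 , const-zero Δg≈0 g₀≈0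
          where
          p q : ℕ → A
          p = Δ f
          q = Δ g

          -- E² - a E - b kills s, so on coefficients it is N composed with Δ.
          NΔ-relation : ∀ n → Nᶠ p q n * s (suc n) + Nᵍ p q n * s n ≈ 0#
          NΔ-relation n = trans
            (solve 12 (λ a b f₂ f₁ f₀ g₂ g₁ g₀ s₃ s₂ s₁ s₀ →
              (a :* (a :* (f₂ :- f₁) :+ (g₂ :- g₁)) :+ b :* ((f₂ :- f₁) :+ (f₁ :- f₀))) :* s₁
              :+ (a :* b :* (f₂ :- f₁) :+ b :* ((g₂ :- g₁) :+ (g₁ :- g₀))) :* s₀ :=
              (f₂ :* s₃ :+ g₂ :* s₂)
              :+ ((:- a) :* (f₁ :* s₂ :+ g₁ :* s₁)
              :+ ((:- b) :* (f₀ :* s₁ :+ g₀ :* s₀)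
              :+ ((:- f₂) :* (s₃ :- (a :* s₂ :+ b :* s₁))
              :+ (:- (a :* f₂ :+ g₂ :- a :* f₁)) :* (s₂ :- (a :* s₁ :+ b :* s₀)))))) refl
              a b (f (suc (suc n))) (f (suc n)) (f n) (g (suc (suc n))) (g (suc n)) (g n)
              (s (suc (suc (suc n)))) (s (suc (suc n))) (s (suc n)) (s n))
            (r (suc (suc n)) ⊕ _ ⊙ r (suc n) ⊕ _ ⊙ r n
              ⊕ _ ⊙ -≈0 (s-rec (suc n)) ⊕ _ ⊙ -≈0 (s-rec n))

          NΔ≈0 : Zero (Nᶠ p q) × Zero (Nᵍ p q)
          NΔ≈0 = homogeneous k
            (deg-+ k (deg-* k a (deg-+ k (deg-* k a (deg-shift k d)) (deg-shift k e)))
                     (deg-* k b (deg-+ k (deg-shift k d) d)))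
            (deg-+ k (deg-* k (a * b) (deg-shift k d))
                     (deg-* k b (deg-+ k (deg-shift k e) e)))
            NΔ-relation

          Δ≈0 : Zero p × Zero q
          Δ≈0 = N-injective k d e (proj₁ NΔ≈0) (proj₂ NΔ≈0)
          Δf≈0 = proj₁ Δ≈0
          Δg≈0 = proj₂ Δ≈0

          const-zero : ∀ {f} → Zero (Δ f) → f 0 ≈ 0# → Zero f
          const-zero Δf≈0 f₀≈0 n = trans (Δ≈0⇒const Δf≈0 n) f₀≈0

          f₀≈0 : f 0 ≈ 0#
          f₀≈0 = casoratian-regular (trans
            -- Cramer's rule; the last two terms replace `f 1` and `g 1` by `f 0` and `g 0`.
            (solve 7 (λ f₁ f₀ g₁ g₀ s₂ s₁ s₀ →
              (s₁ :* s₁ :- s₀ :* s₂) :* f₀ :=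
              s₁ :* (f₀ :* s₁ :+ g₀ :* s₀) :+ ((:- s₀) :* (f₁ :* s₂ :+ g₁ :* s₁)
              :+ ((s₀ :* s₂) :* (f₁ :- f₀) :+ (s₀ :* s₁) :* (g₁ :- g₀)))) refl
              (f 1) (f 0) (g 1) (g 0) (s 2) (s 1) (s 0))
            (_ ⊙ r 0 ⊕ _ ⊙ r 1 ⊕ _ ⊙ Δf≈0 0 ⊕ _ ⊙ Δg≈0 0))

          g₀≈0 : g 0 ≈ 0#
          g₀≈0 = casoratian-regular (trans
            (solve 7 (λ f₁ f₀ g₁ g₀ s₂ s₁ s₀ →
              (s₁ :* s₁ :- s₀ :* s₂) :* g₀ :=
              (:- s₂) :* (f₀ :* s₁ :+ g₀ :* s₀) :+ (s₁ :* (f₁ :* s₂ :+ g₁ :* s₁)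
              :+ ((:- (s₁ :* s₂)) :* (f₁ :- f₀) :+ (:- (s₁ :* s₁)) :* (g₁ :- g₀)))) refl
              (f 1) (f 0) (g 1) (g 0) (s 2) (s 1) (s 0))
            (_ ⊙ r 0 ⊕ _ ⊙ r 1 ⊕ _ ⊙ Δf≈0 0 ⊕ _ ⊙ Δg≈0 0))

        module _ (a+b-1-regular : Regular (a + b - 1#)) where

          -- Subtracting consecutive relations replaces `h` by `Δ h` and applies the operator of
          -- `E-1-injective` to `(f , g)`. This lowers the bound on `h` but not the one on `f` and
          -- `g`, hence the separate `k` and `m`.
          inhomogeneous-fg : ∀ k m {f g h} → Deg< m f → Deg< m g → Deg< k h →
            (∀ n → f n * s (suc n) + g n * s n + h n ≈ 0#) → Zero f × Zero g
          inhomogeneous-fg zero    m d e h≈0 r = homogeneous m d e λ n →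
            trans (sym (trans (+-congˡ (h≈0 n)) (+-identityʳ _))) (r n)
          inhomogeneous-fg (suc k) m {f} {g} {h} d e h-deg r =
            E-1-injective a+b-1-regular m d e (proj₁ IH) (proj₂ IH)
            where
            E-1-relation : ∀ n → (a * f (suc n) + g (suc n) - f n) * s (suc n)
              + (b * f (suc n) - g n) * s n + (h (suc n) - h n) ≈ 0#
            E-1-relation n = trans
              (solve 11 (λ a b f₁ f₀ g₁ g₀ h₁ h₀ s₂ s₁ s₀ →
                (a :* f₁ :+ g₁ :- f₀) :* s₁ :+ (b :* f₁ :- g₀) :* s₀ :+ (h₁ :- h₀) :=
                (f₁ :* s₂ :+ g₁ :* s₁ :+ h₁)
                :+ (con (ℤ.- + 1) :* (f₀ :* s₁ :+ g₀ :* s₀ :+ h₀)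
                :+ (:- f₁) :* (s₂ :- (a :* s₁ :+ b :* s₀)))) refl
                a b (f (suc n)) (f n) (g (suc n)) (g n) (h (suc n)) (h n)
                (s (suc (suc n))) (s (suc n)) (s n))
              (r (suc n) ⊕ _ ⊙ r n ⊕ _ ⊙ -≈0 (s-rec n))

            IH = inhomogeneous-fg k m
              (deg-- m (deg-+ m (deg-* m a (deg-shift m d)) (deg-shift m e)) d)
              (deg-- m (deg-* m b (deg-shift m d)) e)
              h-deg E-1-relation

          inhomogeneous : ∀ k {f g h} → Deg< k f → Deg< k g → Deg< k h →
            (∀ n → f n * s (suc n) + g n * s n + h n ≈ 0#) → Zero f × Zero g × Zero h
          inhomogeneous k {f} {g} {h} d e h-deg r = f≈0 , g≈0 , λ n →
            trans (sym (trans (+-congʳ (fs≈0 n ⊕ gs≈0 n)) (+-identityˡ _))) (r n)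
            where
            fg≈0 : Zero f × Zero g
            fg≈0 = inhomogeneous-fg k k d e h-deg r
            f≈0 = proj₁ fg≈0
            g≈0 = proj₂ fg≈0
            fs≈0 : ∀ n → f n * s (suc n) ≈ 0#
            fs≈0 n = trans (*-congʳ (f≈0 n)) (zeroˡ _)
            gs≈0 : ∀ n → g n * s n ≈ 0#
            gs≈0 n = trans (*-congʳ (g≈0 n)) (zeroˡ _)

-- Equality and arithmetic of Cauchy reals.

open import Defs
open RawMonoidDefinitions +-0-rawMonoid using (sum)

private
  module N = ℕ-Solver.+-*-Solver
  module Z = ℤ-Solver.+-*-Solver

pointwise : ∀ {x y} → (∀ n → seq x n ≡ seq y n) → x ≈ y
pointwise {x} {y} x≡y = mk≈ λ ε 0<ε → 0 , λ n _ →
  ≡.subst (ℚ._< ε)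
    (≡.sym (≡.cong ∣_∣ (≡.trans (≡.cong (ℚ._- seq y n) (x≡y n)) (ℚ.+-inverseʳ (seq y n))))) 0<ε

∣p+q∣<ε : ∀ {ε} p q → ∣ p ∣ ℚ.< ε ℚ.* ℚ.½ → ∣ q ∣ ℚ.< ε ℚ.* ℚ.½ → ∣ p ℚ.+ q ∣ ℚ.< ε
∣p+q∣<ε {ε} p q p< q< = ℚ.≤-<-trans (ℚ.∣p+q∣≤∣p∣+∣q∣ p q)
  (≡.subst (∣ p ∣ ℚ.+ ∣ q ∣ ℚ.<_) (half+half ε) (ℚ.+-mono-< p< q<))

∣p-q∣≡∣q-p∣ : ∀ p q → ∣ p ℚ.- q ∣ ≡ ∣ q ℚ.- p ∣
∣p-q∣≡∣q-p∣ p q = ≡.trans (≡.cong ∣_∣ (neg-sub q p)) (ℚ.∣-p∣≡∣p∣ (q ℚ.- p))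

≈-sym : ∀ {x y} → x ≈ y → y ≈ x
≈-sym {x} {y} (mk≈ p) = mk≈ λ ε 0<ε → let N , f = p ε 0<ε in
  N , λ n n≥ → ≡.subst (ℚ._< ε) (∣p-q∣≡∣q-p∣ (seq x n) (seq y n)) (f n n≥)

≈-trans : ∀ {x y z} → x ≈ y → y ≈ z → x ≈ z
≈-trans {x} {y} {z} (mk≈ p) (mk≈ q) = mk≈ λ ε 0<ε →
  let M , f = p (ε ℚ.* ℚ.½) (half 0<ε)
      N , g = q (ε ℚ.* ℚ.½) (half 0<ε)
  in M ℕ.⊔ N , λ n n≥ →
    ≡.subst (λ d → ∣ d ∣ ℚ.< ε) (telescope (seq x n) (seq y n) (seq z n))
      (∣p+q∣<ε (seq x n ℚ.- seq y n) (seq y n ℚ.- seq z n)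
        (f n (ℕ.m⊔n≤o⇒m≤o M N n≥)) (g n (ℕ.m⊔n≤o⇒n≤o M N n≥)))
  where
  telescope : ∀ p q r → (p ℚ.- q) ℚ.+ (q ℚ.- r) ≡ p ℚ.- r
  telescope = Q.solve 3 (λ p q r → (p Q.:+ (Q.:- q)) Q.:+ (q Q.:+ (Q.:- r)) Q.:= p Q.:+ (Q.:- r)) ≡.refl

+ℝ-cong : ∀ {x x′ y y′} → x ≈ x′ → y ≈ y′ → x + y ≈ x′ + y′
+ℝ-cong {x} {x′} {y} {y′} (mk≈ p) (mk≈ q) = mk≈ λ ε 0<ε →
  let M , f = p (ε ℚ.* ℚ.½) (half 0<ε)
      N , g = q (ε ℚ.* ℚ.½) (half 0<ε)
  in M ℕ.⊔ N , λ n n≥ →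
    ≡.subst (λ d → ∣ d ∣ ℚ.< ε) (≡.sym (+-diff (seq x n) (seq y n) (seq x′ n) (seq y′ n)))
      (∣p+q∣<ε (seq x n ℚ.- seq x′ n) (seq y n ℚ.- seq y′ n)
        (f n (ℕ.m⊔n≤o⇒m≤o M N n≥)) (g n (ℕ.m⊔n≤o⇒n≤o M N n≥)))

-ℝ-cong : ∀ {x y} → x ≈ y → - x ≈ - y
-ℝ-cong {x} {y} (mk≈ p) = mk≈ λ ε 0<ε → let N , f = p ε 0<ε in N , λ n n≥ →
  ≡.subst (ℚ._< ε)
    (≡.trans (≡.sym (ℚ.∣-p∣≡∣p∣ (seq x n ℚ.- seq y n)))
             (≡.cong ∣_∣ (ℚ.neg-distrib-+ (seq x n) (ℚ.- seq y n))))
    (f n n≥)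

*ℝ-cong : ∀ {x x′ y y′} → x ≈ x′ → y ≈ y′ → x * y ≈ x′ * y′
*ℝ-cong {x} {x′} {y} {y′} (mk≈ p) (mk≈ q) = mk≈ λ ε 0<ε →
  -- Bounds on `x` and `y′` suffice because `x y - x′ y′ = x (y - y′) + y′ (x - x′)`.
  let B , 0<B , K , x≤B  = bound (seq x) (cauchy x)
      C , 0<C , L , y′≤C = bound (seq y′) (cauchy y′)
      δ , 0<δ , eq = shrink ε (B ℚ.+ C) 0<ε (ℚ.+-mono-< {0ℚ} {B} {0ℚ} 0<B 0<C)
      M , f = p δ 0<δ
      N , g = q δ 0<δ
  in (M ℕ.⊔ N) ℕ.⊔ (K ℕ.⊔ L) , λ n n≥ →
    let MN = ℕ.m⊔n≤o⇒m≤o (M ℕ.⊔ N) (K ℕ.⊔ L) n≥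
        KL = ℕ.m⊔n≤o⇒n≤o (M ℕ.⊔ N) (K ℕ.⊔ L) n≥
    in ≡.subst (∣ seq x n ℚ.* seq y n ℚ.- seq x′ n ℚ.* seq y′ n ∣ ℚ.<_) eq
      (*-close 0<B 0<C (seq x n) (seq y n) (seq x′ n) (seq y′ n)
        (x≤B n (ℕ.m⊔n≤o⇒m≤o K L KL)) (y′≤C n (ℕ.m⊔n≤o⇒n≤o K L KL))
        (f n (ℕ.m⊔n≤o⇒m≤o M N MN)) (g n (ℕ.m⊔n≤o⇒n≤o M N MN)))

-- Integers as rationals and cancellation of rational factors.

toℚᵘ-/ : ∀ i d → ℚ.toℚᵘ (i ℚ./ suc d) ℚᵘ.≃ mkℚᵘ i d
toℚᵘ-/ i d = ℚ.toℚᵘ-fromℚᵘ (mkℚᵘ i d)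

/1-homo-+ : ∀ i j → (i ℤ.+ j) ℚ./ 1 ≡ i ℚ./ 1 ℚ.+ j ℚ./ 1
/1-homo-+ i j = ℚ.toℚᵘ-injective (begin-equality
  ℚ.toℚᵘ ((i ℤ.+ j) ℚ./ 1)                ≃⟨ toℚᵘ-/ (i ℤ.+ j) 0 ⟩
  mkℚᵘ (i ℤ.+ j) 0                        ≃⟨ ℚᵘ.*≡* (Z.solve 2 (λ i j →
    (i Z.:+ j) Z.:* Z.con (+ 1) Z.:=
    (i Z.:* Z.con (+ 1) Z.:+ j Z.:* Z.con (+ 1)) Z.:* Z.con (+ 1)) ≡.refl i j) ⟩
  mkℚᵘ i 0 ℚᵘ.+ mkℚᵘ j 0                  ≃⟨ ℚᵘ.+-cong (toℚᵘ-/ i 0) (toℚᵘ-/ j 0) ⟨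
  ℚ.toℚᵘ (i ℚ./ 1) ℚᵘ.+ ℚ.toℚᵘ (j ℚ./ 1)  ≃⟨ ℚ.toℚᵘ-homo-+ (i ℚ./ 1) (j ℚ./ 1) ⟨
  ℚ.toℚᵘ (i ℚ./ 1 ℚ.+ j ℚ./ 1)            ∎)
  where open ℚᵘ.≤-Reasoning

/1-homo-* : ∀ i j → (i ℤ.* j) ℚ./ 1 ≡ (i ℚ./ 1) ℚ.* (j ℚ./ 1)
/1-homo-* i j = ℚ.toℚᵘ-injective (begin-equality
  ℚ.toℚᵘ ((i ℤ.* j) ℚ./ 1)                ≃⟨ toℚᵘ-/ (i ℤ.* j) 0 ⟩
  mkℚᵘ i 0 ℚᵘ.* mkℚᵘ j 0                  ≃⟨ ℚᵘ.*-cong (toℚᵘ-/ i 0) (toℚᵘ-/ j 0) ⟨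
  ℚ.toℚᵘ (i ℚ./ 1) ℚᵘ.* ℚ.toℚᵘ (j ℚ./ 1)  ≃⟨ ℚ.toℚᵘ-homo-* (i ℚ./ 1) (j ℚ./ 1) ⟨
  ℚ.toℚᵘ ((i ℚ./ 1) ℚ.* (j ℚ./ 1))        ∎)
  where open ℚᵘ.≤-Reasoning

/1-homo-- : ∀ i → (ℤ.- i) ℚ./ 1 ≡ ℚ.- (i ℚ./ 1)
/1-homo-- i = ℚ.toℚᵘ-injective (begin-equality
  ℚ.toℚᵘ ((ℤ.- i) ℚ./ 1)  ≃⟨ toℚᵘ-/ (ℤ.- i) 0 ⟩
  mkℚᵘ (ℤ.- i) 0          ≃⟨ ℚᵘ.-‿cong (toℚᵘ-/ i 0) ⟨
  ℚᵘ.- ℚ.toℚᵘ (i ℚ./ 1)   ≃⟨ ℚ.toℚᵘ-homo‿- (i ℚ./ 1) ⟨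
  ℚ.toℚᵘ (ℚ.- (i ℚ./ 1))  ∎)
  where open ℚᵘ.≤-Reasoning

-- The reciprocal of `q` is taken in ℚ and embedded as a constant sequence, so no real has to be
-- bounded away from 0.
fromℚ-regular : ∀ q → ¬ q ≡ 0ℚ → ∀ y → fromℚ q * y ≈ 0ℝ → y ≈ 0ℝ
fromℚ-regular q q≢0 y qy≈0 =
  ≈-trans {y} {fromℚ i * (fromℚ q * y)} {0ℝ}
    (pointwise λ n → ≡.trans (≡.sym (ℚ.*-identityˡ (seq y n)))
      (≡.trans (≡.cong (ℚ._* seq y n) (≡.sym (ℚ.*-inverseˡ q))) (ℚ.*-assoc i q (seq y n))))
    (≈-trans {fromℚ i * (fromℚ q * y)} {fromℚ i * 0ℝ} {0ℝ}
      (*ℝ-cong {fromℚ i} {fromℚ i} {fromℚ q * y} {0ℝ} (pointwise λ _ → ≡.refl) qy≈0)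
      (pointwise λ _ → ℚ.*-zeroʳ i))
  where
  instance
    nonZero : ℚ.NonZero q
    nonZero = ℚ.≢-nonZero q≢0
  i : ℚ
  i = ℚ.1/ q

/1-injective-0 : ∀ i → i ℚ./ 1 ≡ 0ℚ → i ≡ 0ℤ
/1-injective-0 i i/1≡0 = ≡.trans (≡.sym (ℤ.*-identityʳ i))
  (ℚᵘ.drop-*≡* (ℚ.fromℚᵘ-injective {mkℚᵘ i 0} {mkℚᵘ 0ℤ 0} i/1≡0))

-- Square roots with a rational value.

square-cancel-≤ : ∀ {m n} → m ℕ.* m ℕ.≤ n ℕ.* n → m ℕ.≤ n
square-cancel-≤ m²≤n² = ℕ.≮⇒≥ λ n<m → ℕ.<⇒≱ (ℕ.*-mono-< n<m n<m) m²≤n²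

square-cancel-< : ∀ {m n} → m ℕ.* m ℕ.< n ℕ.* n → m ℕ.< n
square-cancel-< m²<n² = ℕ.≰⇒> λ n≤m → ℕ.<⇒≱ m²<n² (ℕ.*-mono-≤ n≤m n≤m)

square-* : ∀ m n → (m ℕ.* n) ℕ.* (m ℕ.* n) ≡ (m ℕ.* m) ℕ.* (n ℕ.* n)
square-* = N.solve 2 (λ m n → (m N.:* n) N.:* (m N.:* n) N.:= (m N.:* m) N.:* (n N.:* n)) ≡.refl

module _ (D k M : ℕ) (eq : M ℕ.* M ≡ D ℕ.* (suc k ℕ.* suc k)) where

  private
    square-scaled : ∀ q → (M ℕ.* q) ℕ.* (M ℕ.* q) ≡ (D ℕ.* (q ℕ.* q)) ℕ.* (suc k ℕ.* suc k)
    square-scaled q = ≡.trans (square-* M q) (≡.trans (≡.cong (ℕ._* (q ℕ.* q)) eq)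
      (N.solve 3 (λ d k q → (d N.:* k) N.:* q N.:= (d N.:* q) N.:* k) ≡.refl
        D (suc k ℕ.* suc k) (q ℕ.* q)))

    approx-lower : ∀ q → approx D q ℕ.* suc k ℕ.≤ M ℕ.* q
    approx-lower q = square-cancel-≤ (begin
      (p ℕ.* suc k) ℕ.* (p ℕ.* suc k)          ≡⟨ square-* p (suc k) ⟩
      (p ℕ.* p) ℕ.* (suc k ℕ.* suc k)
        ≤⟨ ℕ.*-monoˡ-≤ (suc k ℕ.* suc k) (proj₁ (isqrt-spec (D ℕ.* (q ℕ.* q)))) ⟩
      (D ℕ.* (q ℕ.* q)) ℕ.* (suc k ℕ.* suc k)  ≡⟨ square-scaled q ⟨
      (M ℕ.* q) ℕ.* (M ℕ.* q)                  ∎)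
      where
      open ℕ.≤-Reasoning
      p = approx D q

    approx-upper : ∀ q → M ℕ.* q ℕ.< suc (approx D q) ℕ.* suc k
    approx-upper q = square-cancel-< (begin-strict
      (M ℕ.* q) ℕ.* (M ℕ.* q)                  ≡⟨ square-scaled q ⟩
      (D ℕ.* (q ℕ.* q)) ℕ.* (suc k ℕ.* suc k)
        <⟨ ℕ.*-monoˡ-< (suc k ℕ.* suc k) (proj₂ (isqrt-spec (D ℕ.* (q ℕ.* q)))) ⟩
      (p ℕ.* p) ℕ.* (suc k ℕ.* suc k)          ≡⟨ square-* p (suc k) ⟨
      (p ℕ.* suc k) ℕ.* (p ℕ.* suc k)          ∎)
      where
      open ℕ.≤-Reasoning
      p = suc (approx D q)

    √-seq-lower : ∀ n → √-seq D n ℚ.≤ + M ℚ./ suc k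
    √-seq-lower n = ℚ.toℚᵘ-cancel-≤ (begin
      ℚ.toℚᵘ (√-seq D n)      ≃⟨ toℚᵘ-/ (+ p) n ⟩
      mkℚᵘ (+ p) n            ≤⟨ ℚᵘ.*≤* (≡.subst₂ ℤ._≤_ (ℤ.pos-* p (suc k)) (ℤ.pos-* M (suc n))
                                   (ℤ.+≤+ (approx-lower (suc n)))) ⟩
      mkℚᵘ (+ M) k            ≃⟨ toℚᵘ-/ (+ M) k ⟨
      ℚ.toℚᵘ (+ M ℚ./ suc k)  ∎)
      where
      open ℚᵘ.≤-Reasoning
      p = approx D (suc n)

    √-seq-upper : ∀ n → + M ℚ./ suc k ℚ.< + 1 ℚ./ suc n ℚ.+ √-seq D n
    √-seq-upper n = ℚ.toℚᵘ-cancel-< (begin-strict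
      ℚ.toℚᵘ (+ M ℚ./ suc k)
        ≃⟨ toℚᵘ-/ (+ M) k ⟩
      mkℚᵘ (+ M) k
        <⟨ ℚᵘ.*<* (≡.subst₂ ℤ._<_ (ℤ.pos-* M (suc n)) (ℤ.pos-* (suc p) (suc k))
             (ℤ.+<+ (approx-upper (suc n)))) ⟩
      mkℚᵘ (+ suc p) n
        ≃⟨ suc-/ p n ⟩
      mkℚᵘ (+ 1) n ℚᵘ.+ mkℚᵘ (+ p) n
        ≃⟨ ℚᵘ.+-cong (toℚᵘ-/ (+ 1) n) (toℚᵘ-/ (+ p) n) ⟨
      ℚ.toℚᵘ (+ 1 ℚ./ suc n) ℚᵘ.+ ℚ.toℚᵘ (√-seq D n)
        ≃⟨ ℚ.toℚᵘ-homo-+ (+ 1 ℚ./ suc n) (√-seq D n) ⟨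
      ℚ.toℚᵘ (+ 1 ℚ./ suc n ℚ.+ √-seq D n) ∎)
      where
      open ℚᵘ.≤-Reasoning
      p = approx D (suc n)

  -- By `eq`, `M / suc k` is an exact root of `D`. Comparing squares shows that the approximation
  -- with denominator `suc n` is at most this root and falls short of it by less than `1 / suc n`.
  √≈/ : √ D ≈ fromℚ (+ M ℚ./ suc k)
  √≈/ = mk≈ λ ε 0<ε → let N , f = 1/suc<ε ε 0<ε in N , λ n n≥ →
    ∣p-q∣<ε
      (≡.subst (ℚ._< ε ℚ.+ + M ℚ./ suc k) (ℚ.+-identityˡ (√-seq D n)) (ℚ.+-mono-<-≤ 0<ε (√-seq-lower n)))
      (ℚ.<-trans (√-seq-upper n) (ℚ.+-monoˡ-< (√-seq D n) (f n n≥)))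

0*x≈0 : ∀ x → fromℕ zero * x ≈ fromℕ zero
0*x≈0 x = pointwise λ n → ℚ.*-zeroˡ (seq x n)

n*[m/n]≡m : ∀ k M → (+ suc k ℚ./ 1) ℚ.* (+ M ℚ./ suc k) ≡ + M ℚ./ 1
n*[m/n]≡m k M = ℚ.toℚᵘ-injective (begin-equality
  ℚ.toℚᵘ ((+ suc k ℚ./ 1) ℚ.* (+ M ℚ./ suc k))            ≃⟨ ℚ.toℚᵘ-homo-* (+ suc k ℚ./ 1) (+ M ℚ./ suc k) ⟩
  ℚ.toℚᵘ (+ suc k ℚ./ 1) ℚᵘ.* ℚ.toℚᵘ (+ M ℚ./ suc k)      ≃⟨ ℚᵘ.*-cong (toℚᵘ-/ (+ suc k) 0) (toℚᵘ-/ (+ M) k) ⟩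
  mkℚᵘ (+ suc k) 0 ℚᵘ.* mkℚᵘ (+ M) k                      ≃⟨ ℚᵘ.*≡* cross-multiplied ⟩
  mkℚᵘ (+ M) 0                                            ≃⟨ toℚᵘ-/ (+ M) 0 ⟨
  ℚ.toℚᵘ (+ M ℚ./ 1)                                      ∎)
  where
  open ℚᵘ.≤-Reasoning
  cross-multiplied : (+ suc k ℤ.* + M) ℤ.* + 1 ≡ + M ℤ.* + (1 ℕ.* suc k)
  cross-multiplied = ≡.trans (ℤ.*-identityʳ _)
    (≡.trans (ℤ.*-comm (+ suc k) (+ M)) (≡.cong (λ l → + M ℤ.* + l) (≡.sym (ℕ.*-identityˡ (suc k)))))

scaled-√ : ∀ D K M → M ℕ.* M ≡ D ℕ.* (K ℕ.* K) → fromℕ K * √ D ≈ fromℕ M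
scaled-√ D zero M eq =
  ≡.subst (λ m → fromℕ zero * √ D ≈ fromℕ m) (≡.sym M≡0) (0*x≈0 (√ D))
  where
  M≡0 : M ≡ zero
  M≡0 = [ id , id ]′ (ℕ.m*n≡0⇒m≡0∨n≡0 M (≡.trans eq (ℕ.*-zeroʳ D)))
scaled-√ D (suc k) M eq =
  ≈-trans {fromℕ (suc k) * √ D} {fromℕ (suc k) * fromℚ (+ M ℚ./ suc k)} {fromℕ M}
    (*ℝ-cong {fromℕ (suc k)} {fromℕ (suc k)} {√ D} {fromℚ (+ M ℚ./ suc k)}
      (pointwise λ _ → ≡.refl) (√≈/ D k M eq))
    (pointwise λ _ → n*[m/n]≡m k M)

-- The reals as an opaque commutative ring containing the integers.

-- Opaque, because conversion checking would otherwise η-expand reals into their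
-- rational sequences and Cauchy moduli.
opaque

  ℝ-commutativeRing : CommutativeRing 0ℓ 0ℓ
  ℝ-commutativeRing = record
    { Carrier = ℝ
    ; _≈_ = _≈_
    ; _+_ = _+_
    ; _*_ = _*_
    ; -_ = -_
    ; 0# = 0ℝ
    ; 1# = fromℕ 1
    ; isCommutativeRing = record
      { isRing = record
        { +-isAbelianGroup = record
          { isGroup = record
            { isMonoid = record
              { isSemigroup = record
                { isMagma = record
                  { isEquivalence = record
                    { refl = pointwise λ _ → ≡.refl ; sym = ≈-sym ; trans = ≈-trans }
                  ; ∙-cong = +ℝ-cong
                  }
                ; assoc = λ x y z → pointwise λ n → ℚ.+-assoc (seq x n) (seq y n) (seq z n)
                }
              ; identity = (λ x → pointwise λ n → ℚ.+-identityˡ (seq x n))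
                         , (λ x → pointwise λ n → ℚ.+-identityʳ (seq x n))
              }
            ; inverse = (λ x → pointwise λ n → ℚ.+-inverseˡ (seq x n))
                      , (λ x → pointwise λ n → ℚ.+-inverseʳ (seq x n))
            ; ⁻¹-cong = -ℝ-cong
            }
          ; comm = λ x y → pointwise λ n → ℚ.+-comm (seq x n) (seq y n)
          }
        ; *-cong = *ℝ-cong
        ; *-assoc = λ x y z → pointwise λ n → ℚ.*-assoc (seq x n) (seq y n) (seq z n)
        ; *-identity = (λ x → pointwise λ n → ℚ.*-identityˡ (seq x n))
                     , (λ x → pointwise λ n → ℚ.*-identityʳ (seq x n))
        ; distrib = (λ x y z → pointwise λ n → ℚ.*-distribˡ-+ (seq x n) (seq y n) (seq z n))
                  , (λ x y z → pointwise λ n → ℚ.*-distribʳ-+ (seq x n) (seq y n) (seq z n))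
        }
      ; *-comm = λ x y → pointwise λ n → ℚ.*-comm (seq x n) (seq y n)
      }
    }

module ℝᵒ = CommutativeRing ℝ-commutativeRing

opaque
  unfolding ℝ-commutativeRing

  -- The identity, kept opaque; outside this block, reals enter and leave the ring through the `ι`
  -- laws alone.
  ι : ℝ → ℝᵒ.Carrier
  ι x = x

  ι-cong : ∀ {x y} → x ≈ y → ι x ℝᵒ.≈ ι y
  ι-cong x≈y = x≈y

  ι-injective : ∀ {x y} → ι x ℝᵒ.≈ ι y → x ≈ y
  ι-injective x≈y = x≈y

  ι-surjective : ∀ y → ∃ λ x → ι x ℝᵒ.≈ y
  ι-surjective y = y , ℝᵒ.refl

  ι-+ : ∀ x y → ι (x + y) ℝᵒ.≈ ι x ℝᵒ.+ ι y
  ι-+ x y = pointwise λ _ → ≡.refl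

  ι-* : ∀ x y → ι (x * y) ℝᵒ.≈ ι x ℝᵒ.* ι y
  ι-* x y = pointwise λ _ → ≡.refl

  ι-- : ∀ x y → ι (x - y) ℝᵒ.≈ ι x ℝᵒ.- ι y
  ι-- x y = pointwise λ _ → ≡.refl

  ι-0 : ι 0ℝ ℝᵒ.≈ ℝᵒ.0#
  ι-0 = pointwise λ _ → ≡.refl

  ⟦_⟧ : ℤ → ℝᵒ.Carrier
  ⟦ i ⟧ = fromℤ i

  ι-fromℤ : ∀ i → ι (fromℤ i) ℝᵒ.≈ ⟦ i ⟧
  ι-fromℤ i = pointwise λ _ → ≡.refl

  ι-fromℚ : ∀ i → ι (fromℚ (i ℚ./ 1)) ℝᵒ.≈ ⟦ i ⟧
  ι-fromℚ i = pointwise λ _ → ≡.refl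

  ⟦⟧-homo-+ : ∀ i j → ⟦ i ℤ.+ j ⟧ ℝᵒ.≈ ⟦ i ⟧ ℝᵒ.+ ⟦ j ⟧
  ⟦⟧-homo-+ i j = pointwise λ _ → /1-homo-+ i j

  ⟦⟧-homo-* : ∀ i j → ⟦ i ℤ.* j ⟧ ℝᵒ.≈ ⟦ i ⟧ ℝᵒ.* ⟦ j ⟧
  ⟦⟧-homo-* i j = pointwise λ _ → /1-homo-* i j

  ⟦⟧-homo-neg : ∀ i → ⟦ ℤ.- i ⟧ ℝᵒ.≈ ℝᵒ.- ⟦ i ⟧
  ⟦⟧-homo-neg i = pointwise λ _ → /1-homo-- i

  ⟦0⟧≈0 : ⟦ 0ℤ ⟧ ℝᵒ.≈ ℝᵒ.0#
  ⟦0⟧≈0 = pointwise λ _ → ≡.refl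

  ⟦1⟧≈1 : ⟦ + 1 ⟧ ℝᵒ.≈ ℝᵒ.1#
  ⟦1⟧≈1 = pointwise λ _ → ≡.refl

⟦⟧-morphism : CommutativeRing.rawRing ℤ.+-*-commutativeRing
  -Raw-AlmostCommutative⟶ fromCommutativeRing ℝ-commutativeRing
⟦⟧-morphism = record
  { ⟦_⟧    = ⟦_⟧
  ; +-homo = ⟦⟧-homo-+
  ; *-homo = ⟦⟧-homo-*
  ; -‿homo = ⟦⟧-homo-neg
  ; 0-homo = ⟦0⟧≈0
  ; 1-homo = ⟦1⟧≈1
  }

open ℝᵒ using (refl; sym; trans; +-cong; +-congˡ; +-congʳ; -‿cong; *-cong; *-congˡ; *-congʳ)
open Algebra.Properties.Group ℝᵒ.+-group using (x∙y⁻¹≈ε⇒x≈y; x≈y⇒x∙y⁻¹≈ε; ⁻¹-involutive)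
open Sequences ℝ-commutativeRing ⟦⟧-morphism

⟦⟧-homo-- : ∀ i j → ⟦ i ℤ.- j ⟧ ℝᵒ.≈ ⟦ i ⟧ ℝᵒ.- ⟦ j ⟧
⟦⟧-homo-- i j = trans (⟦⟧-homo-+ i (ℤ.- j)) (+-congˡ (⟦⟧-homo-neg j))

regular-resp : ∀ {x y} → x ℝᵒ.≈ y → Regular x → Regular y
regular-resp x≈y x-regular yz≈0 = x-regular (trans (*-congʳ x≈y) yz≈0)

ι-regular : ∀ x → (∀ y → x * y ≈ 0ℝ → y ≈ 0ℝ) → Regular (ι x)
ι-regular x x-regular {z} xz≈0 with y , y≈z ← ι-surjective z = trans (sym y≈z)
  (trans (ι-cong (x-regular y
    (ι-injective {x * y} {0ℝ} (trans (ι-* x y) (trans (*-congˡ y≈z) (trans xz≈0 (sym ι-0)))))))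
    ι-0)

⟦⟧-regular : ∀ i → ¬ i ≡ 0ℤ → Regular ⟦ i ⟧
⟦⟧-regular i i≢0 = regular-resp (ι-fromℚ i)
  (ι-regular (fromℚ (i ℚ./ 1)) (fromℚ-regular (i ℚ./ 1) λ i/1≡0 → i≢0 (/1-injective-0 i i/1≡0)))

-- Polynomials are determined by their values at positive integers.

evalᵒ : ℝ[x] → ℕ → ℝᵒ.Carrier
evalᵒ p n = ι (eval p (fromℕ n))

evalᵒ-∷ : ∀ c p n → evalᵒ (c ∷ p) n ℝᵒ.≈ ι c ℝᵒ.+ ⟦ + n ⟧ ℝᵒ.* evalᵒ p n
evalᵒ-∷ c p n = trans (ι-+ c (fromℕ n * eval p (fromℕ n)))
  (+-congˡ (trans (ι-* (fromℕ n) (eval p (fromℕ n))) (*-congʳ (ι-fromℤ (+ n)))))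

-- A Horner step that treats the empty list as the zero polynomial, so that lists of different
-- lengths can be peeled together.
evalᵒ-coeff₀-drop : ∀ p n →
  evalᵒ p n ℝᵒ.≈ ι (coeff p 0) ℝᵒ.+ ⟦ + n ⟧ ℝᵒ.* evalᵒ (drop 1 p) n
evalᵒ-coeff₀-drop []      n = sym (trans (+-congˡ (⟦ + n ⟧ ⊙ ι-0)) (ℝᵒ.+-identityʳ (ι 0ℝ)))
evalᵒ-coeff₀-drop (c ∷ p) n = evalᵒ-∷ c p n

coeff-drop : ∀ p i → coeff (drop 1 p) i ≡ coeff p (suc i)
coeff-drop []      i = ≡.refl
coeff-drop (c ∷ p) i = ≡.refl

⟦⟧-suc : ∀ n → ⟦ + suc n ⟧ ℝᵒ.≈ ⟦ + n ⟧ ℝᵒ.+ ℝᵒ.1#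
⟦⟧-suc n = trans (ℝᵒ.reflexive (≡.cong (λ m → ⟦ + m ⟧) (ℕ.+-comm 1 n)))
  (trans (⟦⟧-homo-+ (+ n) (+ 1)) (+-congˡ ⟦1⟧≈1))

open Polynomial (λ n → ⟦ + n ⟧) ⟦⟧-suc

evalᵒ-deg : ∀ p → Deg< (length p) (evalᵒ p)
evalᵒ-deg []      n = ι-0
evalᵒ-deg (c ∷ p) = deg-cong (suc (length p)) (λ n → sym (evalᵒ-∷ c p n))
  (deg-+ (suc (length p)) (deg-≤ (ℕ.s≤s (ℕ.z≤n {length p})) (deg-const (ι c)))
    (deg-x* (length p) (evalᵒ-deg p)))

evalᵒ-difference-deg : ∀ p q →
  Deg< (length p ℕ.⊔ length q) (λ n → evalᵒ p n ℝᵒ.- evalᵒ q n)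
evalᵒ-difference-deg p q = deg-- (length p ℕ.⊔ length q)
  (deg-≤ (ℕ.m≤m⊔n (length p) (length q)) (evalᵒ-deg p))
  (deg-≤ (ℕ.m≤n⊔m (length p) (length q)) (evalᵒ-deg q))

-- By a Horner step on both lists, `head-tail≈0` yields equal constant coefficients and tails that
-- again agree at positive integers. The recursion is on the index `i`, so either list may run out
-- first.
evalᵒ-injective : ∀ p q → (∀ n → evalᵒ p (suc n) ℝᵒ.- evalᵒ q (suc n) ℝᵒ.≈ ℝᵒ.0#) →
  ∀ i → ι (coeff p i) ℝᵒ.≈ ι (coeff q i)
evalᵒ-injective p q p-q≈0 = λ where
    zero    → x∙y⁻¹≈ε⇒x≈y _ _ (proj₁ head-tail)
    (suc i) → ≡.subst₂ (λ c d → ι c ℝᵒ.≈ ι d) (coeff-drop p i) (coeff-drop q i)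
      (evalᵒ-injective (drop 1 p) (drop 1 q) (proj₂ head-tail) i)
  where
  relation : ∀ n → (ι (coeff p 0) ℝᵒ.- ι (coeff q 0))
    ℝᵒ.+ ⟦ + suc n ⟧ ℝᵒ.* (evalᵒ (drop 1 p) (suc n) ℝᵒ.- evalᵒ (drop 1 q) (suc n)) ℝᵒ.≈ ℝᵒ.0#
  relation n = trans
    (solve 5 (λ c d x u v → (c :- d) :+ x :* (u :- v) := (c :+ x :* u) :- (d :+ x :* v)) refl
      (ι (coeff p 0)) (ι (coeff q 0)) ⟦ + suc n ⟧ (evalᵒ (drop 1 p) (suc n)) (evalᵒ (drop 1 q) (suc n)))
    (trans
      (sym (+-cong (evalᵒ-coeff₀-drop p (suc n)) (-‿cong (evalᵒ-coeff₀-drop q (suc n)))))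
      (p-q≈0 n))
  head-tail = head-tail≈0 ⟦0⟧≈0 (λ n → ⟦⟧-regular (+ suc n) λ ())
    (length (drop 1 p) ℕ.⊔ length (drop 1 q)) (evalᵒ-difference-deg (drop 1 p) (drop 1 q)) relation


-- Signs in the equation `m² = D k²`.

⟦⟧-∣∣ : ∀ i → ⟦ + ℤ.∣ i ∣ ⟧ ℝᵒ.≈ ⟦ i ⟧ ⊎ ⟦ + ℤ.∣ i ∣ ⟧ ℝᵒ.≈ ℝᵒ.- ⟦ i ⟧
⟦⟧-∣∣ i with ℤ.+∣i∣≡i⊎+∣i∣≡-i i
... | inj₁ eq = inj₁ (ℝᵒ.reflexive (≡.cong ⟦_⟧ eq))
... | inj₂ eq = inj₂ (trans (ℝᵒ.reflexive (≡.cong ⟦_⟧ eq)) (⟦⟧-homo-neg i))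

-- Absolute values reduce this to naturals, where `√ D` times the absolute value of `k` is that of
-- `m`. Restoring signs leaves two cases, which will correspond to `j₁` and `j₂`.
√*≈± : ∀ D k m → m ℤ.* m ≡ + D ℤ.* (k ℤ.* k) →
  ι (√ D) ℝᵒ.* ⟦ k ⟧ ℝᵒ.≈ ⟦ m ⟧ ⊎ ι (√ D) ℝᵒ.* ⟦ k ⟧ ℝᵒ.≈ ℝᵒ.- ⟦ m ⟧
√*≈± D k m m²≡Dk² = signs (⟦⟧-∣∣ k) (⟦⟧-∣∣ m)
  where
  r = ι (√ D)

  ∣m∣²≡D∣k∣² : ℤ.∣ m ∣ ℕ.* ℤ.∣ m ∣ ≡ D ℕ.* (ℤ.∣ k ∣ ℕ.* ℤ.∣ k ∣)
  ∣m∣²≡D∣k∣² = ≡.trans (≡.sym (ℤ.abs-* m m)) (≡.trans (≡.cong ℤ.∣_∣ m²≡Dk²)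
    (≡.trans (ℤ.abs-* (+ D) (k ℤ.* k)) (≡.cong (D ℕ.*_) (ℤ.abs-* k k))))

  absolute : ⟦ + ℤ.∣ k ∣ ⟧ ℝᵒ.* r ℝᵒ.≈ ⟦ + ℤ.∣ m ∣ ⟧
  absolute = trans
    (sym (trans (ι-* (fromℕ ℤ.∣ k ∣) (√ D)) (*-congʳ (ι-fromℤ (+ ℤ.∣ k ∣)))))
    (trans (ι-cong (scaled-√ D ℤ.∣ k ∣ ℤ.∣ m ∣ ∣m∣²≡D∣k∣²)) (ι-fromℤ (+ ℤ.∣ m ∣)))

  commuted : ∀ {x} → ⟦ + ℤ.∣ k ∣ ⟧ ℝᵒ.≈ x → x ℝᵒ.* r ℝᵒ.≈ ⟦ + ℤ.∣ m ∣ ⟧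
  commuted x≈ = trans (*-congʳ (sym x≈)) absolute

  negated : ∀ x → r ℝᵒ.* x ℝᵒ.≈ ℝᵒ.- ((ℝᵒ.- x) ℝᵒ.* r)
  negated x = solve 2 (λ r x → r :* x := :- ((:- x) :* r)) refl r x

  signs :
    ⟦ + ℤ.∣ k ∣ ⟧ ℝᵒ.≈ ⟦ k ⟧ ⊎ ⟦ + ℤ.∣ k ∣ ⟧ ℝᵒ.≈ ℝᵒ.- ⟦ k ⟧ →
    ⟦ + ℤ.∣ m ∣ ⟧ ℝᵒ.≈ ⟦ m ⟧ ⊎ ⟦ + ℤ.∣ m ∣ ⟧ ℝᵒ.≈ ℝᵒ.- ⟦ m ⟧ →
    r ℝᵒ.* ⟦ k ⟧ ℝᵒ.≈ ⟦ m ⟧ ⊎ r ℝᵒ.* ⟦ k ⟧ ℝᵒ.≈ ℝᵒ.- ⟦ m ⟧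
  signs (inj₁ k≈) (inj₁ m≈) = inj₁ (trans (ℝᵒ.*-comm r ⟦ k ⟧) (trans (commuted k≈) m≈))
  signs (inj₁ k≈) (inj₂ m≈) = inj₂ (trans (ℝᵒ.*-comm r ⟦ k ⟧) (trans (commuted k≈) m≈))
  signs (inj₂ k≈) (inj₁ m≈) = inj₂ (trans (negated ⟦ k ⟧) (-‿cong (trans (commuted k≈) m≈)))
  signs (inj₂ k≈) (inj₂ m≈) = inj₁ (trans (negated ⟦ k ⟧)
    (trans (-‿cong (trans (commuted k≈) m≈)) (⁻¹-involutive ⟦ m ⟧)))

-- The sum formula transported to the opaque ring.

sum-pointwise : ∀ n {f g : Fin n → ℝ} → (∀ i k → seq (f i) k ≡ seq (g i) k) →
  ∀ k → seq (sum f) k ≡ seq (sum g) k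
sum-pointwise zero    f≡g k = ≡.refl
sum-pointwise (suc n) f≡g k = ≡.cong₂ ℚ._+_ (f≡g zero k) (sum-pointwise n (λ i → f≡g (suc i)) k)

2*sum-pointwise : ∀ n {f g : Fin n → ℝ} → (∀ i k → seq (f i) k ≡ seq (g i) k) →
  ∀ k → seq (fromℕ 2 * sum f) k ≡ seq (fromℕ 2 * sum g) k
2*sum-pointwise n f≡g k = ≡.cong ((+ 2 ℚ./ 1) ℚ.*_) (sum-pointwise n f≡g k)

≈-resp-pointwise : ∀ {x y} x′ y′ → x ≈ y →
  (∀ k → seq x′ k ≡ seq x k) → (∀ k → seq y k ≡ seq y′ k) → x′ ≈ y′
≈-resp-pointwise {x} {y} x′ y′ x≈y x′≡x y≡y′ =
  ≈-trans {x′} {x} {y′} (pointwise x′≡x) (≈-trans {x} {y} {y′} x≈y (pointwise y≡y′))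

combine : (f s g t h : ℝ) → ℝ
combine f s g t h = f * s + g * t + h

ι-combine : ∀ f s g t h →
  ι (combine f s g t h) ℝᵒ.≈ ι f ℝᵒ.* ι s ℝᵒ.+ ι g ℝᵒ.* ι t ℝᵒ.+ ι h
ι-combine f s g t h = trans (ι-+ (f * s + g * t) h)
  (+-congʳ (trans (ι-+ (f * s) (g * t)) (+-cong (ι-* f s) (ι-* g t))))

module _ (a b : ℕ) (c₀ c₁ : ℤ) where

  weightedSum : ℝ[x] → ℕ → ℝ
  weightedSum P n = fromℕ 2 * ∑₁ n (λ k → eval P (fromℕ k) * fromℤ (fib a b c₀ c₁ (k ℕ.∸ 1)))

  combination : ℝ[x] → ℝ[x] → ℝ[x] → ℕ → ℕ → ℝ
  combination F G H n m = combine (eval F (fromℕ n)) (fromℤ (fib a b c₀ c₁ m))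
    (eval G (fromℕ n)) (fromℤ (fib a b c₀ c₁ n)) (eval H (fromℕ n))

  -- Only the rational sequences are compared by computation: comparing the
  -- Cauchy moduli as well is infeasible.
  sumFormula : ∀ P F G H → SumFormula a b c₀ c₁ P (F , G , H) →
    ∀ n → .{{_ : NonZero n}} → weightedSum P n ≈ combination F G H n (n ℕ.+ 1)
  sumFormula P F G H formula n =
    ≈-resp-pointwise (weightedSum P n) (combination F G H n (n ℕ.+ 1)) (formula n)
      (2*sum-pointwise n λ _ _ → ≡.refl) (λ _ → ≡.refl)

  ι-combination : ∀ F G H n m → ι (combination F G H n m) ℝᵒ.≈
    evalᵒ F n ℝᵒ.* ⟦ fib a b c₀ c₁ m ⟧ ℝᵒ.+ evalᵒ G n ℝᵒ.* ⟦ fib a b c₀ c₁ n ⟧ ℝᵒ.+ evalᵒ H n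
  ι-combination F G H n m = trans
    (ι-combine (eval F (fromℕ n)) (fromℤ (fib a b c₀ c₁ m))
      (eval G (fromℕ n)) (fromℤ (fib a b c₀ c₁ n)) (eval H (fromℕ n)))
    (+-congʳ (+-cong (*-congˡ (ι-fromℤ (fib a b c₀ c₁ m))) (*-congˡ (ι-fromℤ (fib a b c₀ c₁ n)))))

  ⟦fib⟧-rec : ∀ n → ⟦ fib a b c₀ c₁ (suc (suc n)) ⟧ ℝᵒ.≈
    ⟦ + a ⟧ ℝᵒ.* ⟦ fib a b c₀ c₁ (suc n) ⟧ ℝᵒ.+ ⟦ + b ⟧ ℝᵒ.* ⟦ fib a b c₀ c₁ n ⟧
  ⟦fib⟧-rec n = trans (⟦⟧-homo-+ (+ a ℤ.* fib a b c₀ c₁ (suc n)) (+ b ℤ.* fib a b c₀ c₁ n))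
    (+-cong (⟦⟧-homo-* (+ a) (fib a b c₀ c₁ (suc n))) (⟦⟧-homo-* (+ b) (fib a b c₀ c₁ n)))

  -- Nonvanishing of the Casoratian.

  private
    -- With `D = a² + 4 b`, the numbers `2 c₁ - j₁ c₀` and `2 c₁ - j₂ c₀` are `m - √ D c₀` and
    -- `m + √ D c₀`.
    m : ℤ
    m = + 2 ℤ.* c₁ ℤ.- + a ℤ.* c₀

  discriminant≡ : + (a ℕ.^ 2 ℕ.+ 4 ℕ.* b) ≡ + a ℤ.* + a ℤ.+ + 4 ℤ.* + b
  discriminant≡ = ≡.cong₂ ℤ._+_
    (≡.trans (≡.cong (λ e → + (a ℕ.* e)) (ℕ.*-identityʳ a)) (ℤ.pos-* a a)) (ℤ.pos-* 4 b)

  -- Writing `W` for the Casoratian and `D` for `a² + 4 b`, one has `b (m² - D c₀²) = - 4 W`. The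
  -- factor `b` appears because `W` uses the indices 1, 2, 3, the sum formula starting at `n = 1`.
  casoratian≡0⇒square : .{{NonZero b}} →
    fib a b c₀ c₁ 2 ℤ.* fib a b c₀ c₁ 2 ℤ.- fib a b c₀ c₁ 1 ℤ.* fib a b c₀ c₁ 3 ≡ 0ℤ →
    m ℤ.* m ≡ + (a ℕ.^ 2 ℕ.+ 4 ℕ.* b) ℤ.* (c₀ ℤ.* c₀)
  casoratian≡0⇒square W≡0 = ℤ.i-j≡0⇒i≡j (m ℤ.* m) (+ (a ℕ.^ 2 ℕ.+ 4 ℕ.* b) ℤ.* (c₀ ℤ.* c₀))
    (ℤ.*-cancelˡ-≡ (+ b) _ 0ℤ (≡.trans scaled (≡.sym (ℤ.*-zeroʳ (+ b)))))
    where
    scaled : + b ℤ.* (m ℤ.* m ℤ.- + (a ℕ.^ 2 ℕ.+ 4 ℕ.* b) ℤ.* (c₀ ℤ.* c₀)) ≡ 0ℤ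
    scaled = ≡.trans (≡.cong (λ d → + b ℤ.* (m ℤ.* m ℤ.- d ℤ.* (c₀ ℤ.* c₀))) discriminant≡)
      (≡.trans
        (Z.solve 4 (λ a b c₀ c₁ →
          let m = Z.con (+ 2) Z.:* c₁ Z.:- a Z.:* c₀
              S₂ = a Z.:* c₁ Z.:+ b Z.:* c₀
              S₃ = a Z.:* S₂ Z.:+ b Z.:* c₁
          in b Z.:* (m Z.:* m Z.:- (a Z.:* a Z.:+ Z.con (+ 4) Z.:* b) Z.:* (c₀ Z.:* c₀)) Z.:=
             Z.con (ℤ.- + 4) Z.:* (S₂ Z.:* S₂ Z.:- c₁ Z.:* S₃)) ≡.refl (+ a) (+ b) c₀ c₁)
        (≡.cong (ℤ.- + 4 ℤ.*_) W≡0))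

  ⟦m⟧≈ : ⟦ m ⟧ ℝᵒ.≈ ⟦ + 2 ⟧ ℝᵒ.* ⟦ c₁ ⟧ ℝᵒ.- ⟦ + a ⟧ ℝᵒ.* ⟦ c₀ ⟧
  ⟦m⟧≈ = trans (⟦⟧-homo-- (+ 2 ℤ.* c₁) (+ a ℤ.* c₀))
    (+-cong (⟦⟧-homo-* (+ 2) c₁) (-‿cong (⟦⟧-homo-* (+ a) c₀)))

  ι-2c₁-j₁c₀ : ι (fromℕ 2 * fromℤ c₁ - j₁ a b * fromℤ c₀) ℝᵒ.≈
    ⟦ + 2 ⟧ ℝᵒ.* ⟦ c₁ ⟧ ℝᵒ.- (⟦ + a ⟧ ℝᵒ.+ ι (√ (a ℕ.^ 2 ℕ.+ 4 ℕ.* b))) ℝᵒ.* ⟦ c₀ ⟧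
  ι-2c₁-j₁c₀ = trans (ι-- (fromℕ 2 * fromℤ c₁) (j₁ a b * fromℤ c₀))
    (+-cong (trans (ι-* (fromℕ 2) (fromℤ c₁)) (*-cong (ι-fromℤ (+ 2)) (ι-fromℤ c₁)))
      (-‿cong (trans (ι-* (j₁ a b) (fromℤ c₀))
        (*-cong (trans (ι-+ (fromℕ a) (√ (a ℕ.^ 2 ℕ.+ 4 ℕ.* b))) (+-congʳ (ι-fromℤ (+ a)))) (ι-fromℤ c₀)))))

  ι-2c₁-j₂c₀ : ι (fromℕ 2 * fromℤ c₁ - j₂ a b * fromℤ c₀) ℝᵒ.≈
    ⟦ + 2 ⟧ ℝᵒ.* ⟦ c₁ ⟧ ℝᵒ.- (⟦ + a ⟧ ℝᵒ.- ι (√ (a ℕ.^ 2 ℕ.+ 4 ℕ.* b))) ℝᵒ.* ⟦ c₀ ⟧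
  ι-2c₁-j₂c₀ = trans (ι-- (fromℕ 2 * fromℤ c₁) (j₂ a b * fromℤ c₀))
    (+-cong (trans (ι-* (fromℕ 2) (fromℤ c₁)) (*-cong (ι-fromℤ (+ 2)) (ι-fromℤ c₁)))
      (-‿cong (trans (ι-* (j₂ a b) (fromℤ c₀))
        (*-cong (trans (ι-- (fromℕ a) (√ (a ℕ.^ 2 ℕ.+ 4 ℕ.* b))) (+-congʳ (ι-fromℤ (+ a)))) (ι-fromℤ c₀)))))

  root₁ : ι (√ (a ℕ.^ 2 ℕ.+ 4 ℕ.* b)) ℝᵒ.* ⟦ c₀ ⟧ ℝᵒ.≈ ⟦ m ⟧ →
    fromℕ 2 * fromℤ c₁ - j₁ a b * fromℤ c₀ ≈ 0ℝ
  root₁ rc₀≈m = ι-injective {fromℕ 2 * fromℤ c₁ - j₁ a b * fromℤ c₀} {0ℝ}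
    (trans ι-2c₁-j₁c₀ (trans
      (solve 4 (λ c₁ a r c₀ → con (+ 2) :* c₁ :- (a :+ r) :* c₀ :=
        (con (+ 2) :* c₁ :- a :* c₀) :- r :* c₀) refl
        ⟦ c₁ ⟧ ⟦ + a ⟧ (ι (√ (a ℕ.^ 2 ℕ.+ 4 ℕ.* b))) ⟦ c₀ ⟧)
      (trans (x≈y⇒x∙y⁻¹≈ε (trans (sym ⟦m⟧≈) (sym rc₀≈m))) (sym ι-0))))

  root₂ : ι (√ (a ℕ.^ 2 ℕ.+ 4 ℕ.* b)) ℝᵒ.* ⟦ c₀ ⟧ ℝᵒ.≈ ℝᵒ.- ⟦ m ⟧ →
    fromℕ 2 * fromℤ c₁ - j₂ a b * fromℤ c₀ ≈ 0ℝ
  root₂ rc₀≈-m = ι-injective {fromℕ 2 * fromℤ c₁ - j₂ a b * fromℤ c₀} {0ℝ}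
    (trans ι-2c₁-j₂c₀ (trans
      (solve 4 (λ c₁ a r c₀ → con (+ 2) :* c₁ :- (a :- r) :* c₀ :=
        r :* c₀ :+ (con (+ 2) :* c₁ :- a :* c₀)) refl
        ⟦ c₁ ⟧ ⟦ + a ⟧ (ι (√ (a ℕ.^ 2 ℕ.+ 4 ℕ.* b))) ⟦ c₀ ⟧)
      (trans (+-cong rc₀≈-m (sym ⟦m⟧≈)) (trans (ℝᵒ.-‿inverseˡ ⟦ m ⟧) (sym ι-0)))))

  -- A zero Casoratian makes `√ D c₀` equal to `m` or `- m`, which annihilates `2 c₁ - j₁ c₀` or
  -- `2 c₁ - j₂ c₀` respectively.
  casoratian≢0 : .{{NonZero b}} →
    fromℕ 2 * fromℤ c₁ - j₁ a b * fromℤ c₀ ≉ 0ℝ →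
    fromℕ 2 * fromℤ c₁ - j₂ a b * fromℤ c₀ ≉ 0ℝ →
    ¬ fib a b c₀ c₁ 2 ℤ.* fib a b c₀ c₁ 2 ℤ.- fib a b c₀ c₁ 1 ℤ.* fib a b c₀ c₁ 3 ≡ 0ℤ
  casoratian≢0 j₁≉ j₂≉ W≡0 = [ j₁≉ ∘ root₁ , j₂≉ ∘ root₂ ]′
    (√*≈± (a ℕ.^ 2 ℕ.+ 4 ℕ.* b) c₀ m (casoratian≡0⇒square W≡0))

  casoratian-regular :
    ¬ fib a b c₀ c₁ 2 ℤ.* fib a b c₀ c₁ 2 ℤ.- fib a b c₀ c₁ 1 ℤ.* fib a b c₀ c₁ 3 ≡ 0ℤ →
    Regular (⟦ fib a b c₀ c₁ 2 ⟧ ℝᵒ.* ⟦ fib a b c₀ c₁ 2 ⟧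
      ℝᵒ.- ⟦ fib a b c₀ c₁ 1 ⟧ ℝᵒ.* ⟦ fib a b c₀ c₁ 3 ⟧)
  casoratian-regular W≢0 = regular-resp
    (trans (⟦⟧-homo-- (s₂ ℤ.* s₂) (s₁ ℤ.* s₃))
      (+-cong (⟦⟧-homo-* s₂ s₂) (-‿cong (⟦⟧-homo-* s₁ s₃))))
    (⟦⟧-regular (s₂ ℤ.* s₂ ℤ.- s₁ ℤ.* s₃) W≢0)
    where
    s₁ = fib a b c₀ c₁ 1
    s₂ = fib a b c₀ c₁ 2
    s₃ = fib a b c₀ c₁ 3

  -- Both right-hand sides equal the same weighted sum, so subtraction eliminates `P`. The instance
  -- `n = 0` here is the formula at 1.
  difference-relation : ∀ P F G H F′ G′ H′ →
    SumFormula a b c₀ c₁ P (F , G , H) → SumFormula a b c₀ c₁ P (F′ , G′ , H′) → ∀ n →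
    (evalᵒ F (suc n) ℝᵒ.- evalᵒ F′ (suc n)) ℝᵒ.* ⟦ fib a b c₀ c₁ (suc (suc n)) ⟧
      ℝᵒ.+ (evalᵒ G (suc n) ℝᵒ.- evalᵒ G′ (suc n)) ℝᵒ.* ⟦ fib a b c₀ c₁ (suc n) ⟧
      ℝᵒ.+ (evalᵒ H (suc n) ℝᵒ.- evalᵒ H′ (suc n)) ℝᵒ.≈ ℝᵒ.0#
  difference-relation P F G H F′ G′ H′ formula formula′ n = trans
    (+-congʳ (+-congʳ (*-congˡ (ℝᵒ.reflexive
      (≡.cong (λ i → ⟦ fib a b c₀ c₁ (suc i) ⟧) (ℕ.+-comm 1 n))))))
    (trans
      (solve 8 (λ f f′ g g′ h h′ s₁ s₀ →
        (f :- f′) :* s₁ :+ (g :- g′) :* s₀ :+ (h :- h′) :=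
        (f :* s₁ :+ g :* s₀ :+ h) :- (f′ :* s₁ :+ g′ :* s₀ :+ h′)) refl
        (evalᵒ F (suc n)) (evalᵒ F′ (suc n)) (evalᵒ G (suc n)) (evalᵒ G′ (suc n))
        (evalᵒ H (suc n)) (evalᵒ H′ (suc n))
        ⟦ fib a b c₀ c₁ (suc n ℕ.+ 1) ⟧ ⟦ fib a b c₀ c₁ (suc n) ⟧)
      (x≈y⇒x∙y⁻¹≈ε (trans (sym (ι-formula F G H formula)) (ι-formula F′ G′ H′ formula′))))
    where
    ι-formula : ∀ F G H → SumFormula a b c₀ c₁ P (F , G , H) →
      ι (weightedSum P (suc n)) ℝᵒ.≈ evalᵒ F (suc n) ℝᵒ.* ⟦ fib a b c₀ c₁ (suc n ℕ.+ 1) ⟧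
        ℝᵒ.+ evalᵒ G (suc n) ℝᵒ.* ⟦ fib a b c₀ c₁ (suc n) ⟧ ℝᵒ.+ evalᵒ H (suc n)
    ι-formula F G H formula = trans
      (ι-cong {weightedSum P (suc n)} {combination F G H (suc n) (suc n ℕ.+ 1)}
        (sumFormula P F G H formula (suc n)))
      (ι-combination F G H (suc n) (suc n ℕ.+ 1))

discriminant-regular : ∀ a b → .{{NonZero b}} →
  Regular (⟦ + a ⟧ ℝᵒ.* ⟦ + a ⟧ ℝᵒ.+ ⟦ + 4 ⟧ ℝᵒ.* ⟦ + b ⟧)
discriminant-regular a b@(suc _) = regular-resp
  (trans (⟦⟧-homo-+ (+ a ℤ.* + a) (+ 4 ℤ.* + b))
    (+-cong (⟦⟧-homo-* (+ a) (+ a)) (⟦⟧-homo-* (+ 4) (+ b))))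
  (⟦⟧-regular (+ a ℤ.* + a ℤ.+ + 4 ℤ.* + b) λ eq →
    ℕ.m+1+n≢0 (a ℕ.* a) (ℤ.+-injective (≡.trans (≡.cong (ℤ._+ + 4 ℤ.* + b) (ℤ.pos-* a a)) eq)))

a+b-1-regular : ∀ a b → .{{NonZero a}} → .{{NonZero b}} →
  Regular (⟦ + a ⟧ ℝᵒ.+ ⟦ + b ⟧ ℝᵒ.- ℝᵒ.1#)
a+b-1-regular (suc a) b@(suc _) = regular-resp
  (trans (⟦⟧-homo-- (+ suc a ℤ.+ + b) (+ 1)) (+-cong (⟦⟧-homo-+ (+ suc a) (+ b)) (-‿cong ⟦1⟧≈1)))
  -- The integer computes to `+ (a + b)` with `a` now the predecessor, and `b` is a successor.
  (⟦⟧-regular (+ suc a ℤ.+ + b ℤ.- + 1) λ eq → ℕ.m+1+n≢0 a (ℤ.+-injective eq))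

-- Uniqueness of the triple.

theorem3p2 : (a b : ℕ) .{{_ : NonZero a}} .{{_ : NonZero b}} (c₀ c₁ : ℤ) →
    ¬ (c₀ ≡ 0ℤ × c₁ ≡ 0ℤ) →
    fromℕ 2 * fromℤ c₁ - j₁ a b * fromℤ c₀ ≉ 0ℝ →
    fromℕ 2 * fromℤ c₁ - j₂ a b * fromℤ c₀ ≉ 0ℝ →
    (P F G H F′ G′ H′ : ℝ[x]) →
    SumFormula a b c₀ c₁ P (F , G , H) →
    SumFormula a b c₀ c₁ P (F′ , G′ , H′) →
    F ≈ₚ F′ × G ≈ₚ G′ × H ≈ₚ H′
theorem3p2 a b c₀ c₁ _ j₁≉ j₂≉ P F G H F′ G′ H′ formula formula′ =
  unique F F′ (proj₁ vanish) , unique G G′ (proj₁ (proj₂ vanish))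
  , unique H H′ (proj₂ (proj₂ vanish))
  where
  unique : ∀ p q → Zero (λ n → evalᵒ p (suc n) ℝᵒ.- evalᵒ q (suc n)) → p ≈ₚ q
  unique p q p-q≈0 i = ι-injective {coeff p i} {coeff q i} (evalᵒ-injective p q p-q≈0 i)

  deg : ℝ[x] → ℝ[x] → ℕ
  deg p q = length p ℕ.⊔ length q

  -- `inhomogeneous` takes one degree bound for all three differences.
  k : ℕ
  k = deg F F′ ℕ.⊔ (deg G G′ ℕ.⊔ deg H H′)

  difference-deg : ∀ p q → deg p q ℕ.≤ k →
    Deg< k (λ n → evalᵒ p (suc n) ℝᵒ.- evalᵒ q (suc n))
  difference-deg p q ≤k = deg-shift k (deg-≤ ≤k (evalᵒ-difference-deg p q))

  vanish : Zero (λ n → evalᵒ F (suc n) ℝᵒ.- evalᵒ F′ (suc n))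
    × Zero (λ n → evalᵒ G (suc n) ℝᵒ.- evalᵒ G′ (suc n))
    × Zero (λ n → evalᵒ H (suc n) ℝᵒ.- evalᵒ H′ (suc n))
  vanish = Recurrence.inhomogeneous ⟦ + a ⟧ ⟦ + b ⟧
    (⟦⟧-regular (+ b) λ b≡0 → ℕ.≢-nonZero⁻¹ b (ℤ.+-injective b≡0))
    (discriminant-regular a b)
    -- The recurrence is entered at index 1, in step with the shifted coefficient sequences.
    (λ n → ⟦ fib a b c₀ c₁ (suc n) ⟧) (λ n → ⟦fib⟧-rec a b c₀ c₁ (suc n))
    (casoratian-regular a b c₀ c₁ (casoratian≢0 a b c₀ c₁ j₁≉ j₂≉))
    (a+b-1-regular a b)
    k
    (difference-deg F F′ (ℕ.m≤m⊔n (deg F F′) _))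
    (difference-deg G G′ (ℕ.≤-trans (ℕ.m≤m⊔n (deg G G′) (deg H H′)) (ℕ.m≤n⊔m (deg F F′) _)))
    (difference-deg H H′ (ℕ.≤-trans (ℕ.m≤n⊔m (deg G G′) (deg H H′)) (ℕ.m≤n⊔m (deg F F′) _)))
    (difference-relation a b c₀ c₁ P F G H F′ G′ H′ formula formula′)
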